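{- Let $\mathcal{A}$ be a simple maxout arrangement of $m\ge n+1$ maxout units of ranks $k_1,\dots,k_m\ge2$ in $\mathbb{R}^n$. Then $$r(\mathcal{A})=\sum_{j=0}^{n}(-1)^{n-j}\binom{m-1-j}{n-j}\sum_{S\in\binom{[m]}{j}}r(\mathcal{A}_S).$$
   Context: Maxout arrangement in $\mathbb{R}^n$: given $m$ maxout units $z_i(x)=\max\{A_{i,1}(x),\dots,A_{i,k_i}(x)\}$, $x\in\mathbb{R}^n$, with affine functions $A_{i,a}$, the arrangement is $\mathcal{A}=\{H^i_{ab}: i\in[m],\{a,b\}\in\binom{[k_i]}{2},\ \operatorname{codim}H^i_{ab}=1\}$, where $H^i_{ab}=\{x: A_{i,a}(x)=A_{i,b}(x)=\max_{c\in[k_i]}A_{i,c}(x)\}$. Its elements are called atoms. For $S\subseteq[m]$, $\mathcal{A}_S$ is the sub-arrangement of atoms of units $i\in S$ ($\mathcal{A}_\emptyset$ is empty). $r(\mathcal{A})$ is the number of connected components of $\mathbb{R}^n\setminus\bigcup_{H\in\mathcal{A}}H$, so $r(\mathcal{A}_\emptyset)=1$. The arrangement is simple (in general position) if, for every $j$, the intersection of any $j$ atoms of (pairwise) different units is either empty or has codimension $j$ (in particular it is empty for $j>n$). $[m]=\{1,\dots,m\}$ and $\binom{[m]}{j}$ is the set of $j$-element subsets of $[m]$. -}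

module Defs where

open import Level using (0ℓ) renaming (suc to lsuc)
open import Algebra.Bundles using (CommutativeRing)
import Algebra.Properties.Monoid.Sum as MonoidSum
open import Data.Fin.Base as Fin using (Fin)
open import Data.Fin.Subset as Subset using (Subset; inside; outside; ∣_∣)
open import Data.List.Base as List using (List; _++_)
open import Data.Nat.Base as ℕ using (ℕ; zero; suc)
import Data.Nat.Properties as ℕ
open import Data.Product.Base using (Σ-syntax; ∃; ∃-syntax; _×_; _,_; proj₁)
open import Data.Sum.Base using (_⊎_; inj₁; inj₂)
open import Data.Vec.Base using ([]; _∷_)
open import Data.Vec.Functional using (Vector)
open import Function.Bundles using (Bijection)
open import Function.Definitions using (Injective)
open import Relation.Binary.Bundles using (Setoid)
open import Relation.Binary.Core using (Rel)
open import Relation.Binary.PropositionalEquality as ≡ using (_≡_)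
import Relation.Binary.Construct.NonStrictToStrict as ToStrict
open import Relation.Binary.Structures using (IsTotalOrder)
open import Relation.Nullary using (¬_)
open import Relation.Unary
  using (Pred; _∈_; _∉_; _⊆_; _∩_; _∪_; ⋂; Empty; Satisfiable)

-- The real numbers, axiomatised as a complete ordered field: classically this
-- determines ℝ up to unique isomorphism.

record RealNumbers : Set₁ where
  field
    commutativeRing : CommutativeRing 0ℓ 0ℓ

  open CommutativeRing commutativeRing public

  infix 4 _≤_
  field
    0≉1          : ¬ 0# ≈ 1#
    invertible   : ∀ x → ¬ x ≈ 0# → ∃[ y ] x * y ≈ 1#
    _≤_          : Rel Carrier 0ℓ
    isTotalOrder : IsTotalOrder _≈_ _≤_
    +-monoˡ-≤    : ∀ {x y} z → x ≤ y → x + z ≤ y + z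
    *-nonneg     : ∀ {x y} → 0# ≤ x → 0# ≤ y → 0# ≤ x * y

  UpperBound : Pred Carrier 0ℓ → Pred Carrier 0ℓ
  UpperBound P u = ∀ x → x ∈ P → x ≤ u

  field
    supremum : ∀ P → Satisfiable P → Satisfiable (UpperBound P) →
               ∃[ s ] s ∈ UpperBound P × (∀ u → u ∈ UpperBound P → s ≤ u)

  open ToStrict _≈_ _≤_ public using (_<_)
  open MonoidSum +-monoid public using (sum; sum-syntax)

module _ (ℛ : RealNumbers) where
  open RealNumbers ℛ

  Point : ℕ → Set
  Point n = Vector Carrier n

  -- The ambient topology, given by the sup-norm balls.

  Ball : ∀ {n} → Point n → Carrier → Pred (Point n) 0ℓ
  Ball x ε y = ∀ t → x t - ε < y t × y t < x t + ε

  IsOpen : ∀ {n} → Pred (Point n) 0ℓ → Set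
  IsOpen U = ∀ x → x ∈ U → ∃[ ε ] 0# < ε × Ball x ε ⊆ U

  -- The relatively open subsets of C are the sets C ∩ U with U open in the
  -- ambient space.  The empty set is connected under this definition, which
  -- is harmless: below, connected sets always contain a given point.

  IsConnected : ∀ {n} → Pred (Point n) 0ℓ → Set₁
  IsConnected {n} C = ∀ (U V : Pred (Point n) 0ℓ) → IsOpen U → IsOpen V →
    C ⊆ U ∪ V → Satisfiable (C ∩ U) → Satisfiable (C ∩ V) →
    Satisfiable (C ∩ (U ∩ V))

  SameComponent : ∀ {n} → Pred (Point n) 0ℓ → Point n → Point n → Set₁
  SameComponent {n} X x y =
    Σ[ C ∈ Pred (Point n) 0ℓ ] C ⊆ X × IsConnected C × x ∈ C × y ∈ C

  private
    singleton-connected : ∀ {n} (x : Point n) → IsConnected (_≡ x)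
    singleton-connected x U V _ _ _ (_ , ≡.refl , xU) (_ , ≡.refl , xV) =
      x , ≡.refl , xU , xV

    ∪-connected : ∀ {n} {C D : Pred (Point n) 0ℓ} {y : Point n} →
                  IsConnected C → IsConnected D → y ∈ C → y ∈ D →
                  IsConnected (C ∪ D)
    ∪-connected {C = C} {D} {y} cC cD yC yD U V oU oV cov = go
      where
      inC : Satisfiable (C ∩ U) → Satisfiable (C ∩ V) →
            Satisfiable ((C ∪ D) ∩ (U ∩ V))
      inC u v with cC U V oU oV (λ p → cov (inj₁ p)) u v
      ... | z , zC , zUV = z , inj₁ zC , zUV
      inD : Satisfiable (D ∩ U) → Satisfiable (D ∩ V) →
            Satisfiable ((C ∪ D) ∩ (U ∩ V))
      inD u v with cD U V oU oV (λ p → cov (inj₂ p)) u v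
      ... | z , zD , zUV = z , inj₂ zD , zUV
      go : Satisfiable ((C ∪ D) ∩ U) → Satisfiable ((C ∪ D) ∩ V) →
           Satisfiable ((C ∪ D) ∩ (U ∩ V))
      go (u , uCD , uU) (v , vCD , vV) with cov (inj₁ yC) | uCD | vCD
      ... | inj₁ yU | _       | inj₁ vC = inC (y , yC , yU) (v , vC , vV)
      ... | inj₁ yU | _       | inj₂ vD = inD (y , yD , yU) (v , vD , vV)
      ... | inj₂ yV | inj₁ uC | _       = inC (u , uC , uU) (y , yC , yV)
      ... | inj₂ yV | inj₂ uD | _       = inD (u , uD , uU) (y , yD , yV)

  -- The set of connected components of X: the points of X, two points being
  -- identified when they lie in a common connected subset of X.

  Components : ∀ {n} → Pred (Point n) 0ℓ → Setoid 0ℓ (lsuc 0ℓ)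
  Components X = record
    { Carrier       = ∃ X
    ; _≈_           = λ x y → SameComponent X (proj₁ x) (proj₁ y)
    ; isEquivalence = record
      { refl  = λ { {x , xX} →
          (_≡ x) , (λ { ≡.refl → xX }) , singleton-connected x , ≡.refl , ≡.refl }
      ; sym   = λ { (C , C⊆X , cC , xC , yC) → C , C⊆X , cC , yC , xC }
      ; trans = λ { (C , C⊆X , cC , xC , yC) (D , D⊆X , cD , yD , zD) →
          C ∪ D
        , (λ { (inj₁ p) → C⊆X p ; (inj₂ p) → D⊆X p })
        , ∪-connected cC cD yC yD , inj₁ xC , inj₂ zD }
      }
    }

  HasComponents : ∀ {n} → Pred (Point n) 0ℓ → ℕ → Set₁
  HasComponents X N = Bijection (≡.setoid (Fin N)) (Components X)

  AffinelyIndependent : ∀ {n k} → (Fin k → Point n) → Set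
  AffinelyIndependent {n} {k} p = ∀ (c : Vector Carrier k) → sum c ≈ 0# →
    (∀ t → ∑[ s < k ] (c s * p s t) ≈ 0#) → ∀ s → c s ≈ 0#

  AffineSpan : ∀ {n k} → (Fin k → Point n) → Pred (Point n) 0ℓ
  AffineSpan {n} {k} p x = Σ[ c ∈ Vector Carrier k ]
    sum c ≈ 1# × (∀ t → x t ≈ ∑[ s < k ] (c s * p s t))

  -- The dimension of a set is that of its affine hull: d + 1 points of X form
  -- an affine basis of the hull of X.  In particular X is nonempty, so the
  -- empty set has no dimension and no codimension.

  record HasDimension {n} (X : Pred (Point n) 0ℓ) (d : ℕ) : Set where
    field
      basis       : Fin (suc d) → Point n
      basis∈X     : ∀ s → basis s ∈ X
      independent : AffinelyIndependent basis
      spanning    : X ⊆ AffineSpan basis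

  HasCodimension : ∀ {n} → Pred (Point n) 0ℓ → ℕ → Set
  HasCodimension {n} X j = ∃[ d ] HasDimension X d × d ℕ.+ j ≡ n

  record AffineFunction (n : ℕ) : Set where
    field
      slope    : Vector Carrier n
      constant : Carrier

    eval : Point n → Carrier
    eval x = ∑[ t < n ] (slope t * x t) + constant

  open AffineFunction using (eval)

  -- m maxout units on ℝⁿ, unit i having rank k i.

  record MaxoutUnits (n m : ℕ) : Set where
    field
      rank  : Fin m → ℕ
      piece : ∀ i → Fin (rank i) → AffineFunction n

    H : ∀ i → Fin (rank i) → Fin (rank i) → Pred (Point n) 0ℓ
    H i a b x = eval (piece i a) x ≈ eval (piece i b) x
              × (∀ c → eval (piece i c) x ≤ eval (piece i a) x)

    -- The two-element subsets {a , b} are represented by the pairs a < b.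

    record Atom (i : Fin m) : Set where
      field
        a b   : Fin (rank i)
        a<b   : a Fin.< b
        codim : HasCodimension (H i a b) 1

      carrier : Pred (Point n) 0ℓ
      carrier = H i a b

  module _ {n m : ℕ} (A : MaxoutUnits n m) where
    open MaxoutUnits A

    -- For j = 0 the intersection is the whole space, of codimension 0.

    IsSimple : Set
    IsSimple = ∀ {j} (u : Fin j → Fin m) → Injective _≡_ _≡_ u →
      (h : ∀ t → Atom (u t)) →
      let I = ⋂ (Fin j) (λ t → Atom.carrier (h t)) in
      Empty I ⊎ HasCodimension I j

    -- The complement of the union of the atoms of the units in S.

    Complement : Subset m → Pred (Point n) 0ℓ
    Complement S x = ∀ i → i Subset.∈ S → (h : Atom i) → x ∉ Atom.carrier h

    RegionCount : Subset m → ℕ → Set₁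
    RegionCount S N = HasComponents (Complement S) N

subsets : ∀ m → List (Subset m)
subsets zero    = List.[ [] ]
subsets (suc m) =
  List.map (outside ∷_) (subsets m) ++ List.map (inside ∷_) (subsets m)

subsetsOfSize : ∀ m → ℕ → List (Subset m)
subsetsOfSize m j = List.filter (λ S → ∣ S ∣ ℕ.≟ j) (subsets m)

{-# OPTIONS --safe #-}

-- The points of ℝⁿ avoiding the atoms of the units in S are partitioned by open
-- convex cells, one for each choice of a strictly maximal piece in every unit of S,
-- so r(S) counts the nonempty cells.  An integer relation between the indicator
-- functions of open convex sets also holds between the numbers ⟦ P nonempty ⟧: this is
-- the Euler characteristic, and it follows by induction on the dimension from the
-- case of intervals, where the jumps of the relation at each right end vanish.
-- By simplicity a point lies on atoms of at most n units, hence
-- Σ_{S ⊆ T} (-1)^|S| [x avoids the atoms of S] = 0 whenever |T| > n.  Summing these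
-- relations with sign (-1)^|T| over all T with |T| > n leaves the coefficient 1 at
-- S = [m], -(-1)^(n-j) C(m-1-j, n-j) at |S| = j ≤ n, and 0 elsewhere.

module Submission where

open import Defs
import Algebra.Properties.CommutativeMonoid.Sum as CommutativeMonoidSum
import Algebra.Properties.Monoid.Sum as MonoidSum
import Algebra.Properties.Semiring.Sum as SemiringSum
import Algebra.Solver.Ring as RingSolver
open import Algebra.Solver.Ring.AlmostCommutativeRing using (_-Raw-AlmostCommutative⟶_; fromCommutativeRing)
open import Axiom.ExcludedMiddle using (ExcludedMiddle)
open import Data.Bool.Base using (if_then_else_)
open import Data.Empty using (⊥-elim)
open import Data.Fin.Base as Fin using (Fin; zero; suc; toℕ; punchIn)
import Data.Fin.Properties as Fin
open import Data.Fin.Subset as Subset using (Subset; inside; outside; ∣_∣)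
import Data.Fin.Subset.Properties as Subset
open import Data.Integer.Base as ℤ using (ℤ; +_; 0ℤ; 1ℤ; -1ℤ)
import Data.Integer.Properties as ℤ
open import Data.Integer.Solver using (module +-*-Solver)
open import Data.List.Base as List using (List; []; _∷_; _++_)
import Data.List.Membership.Propositional.Properties as ∈ₗ
import Data.List.Properties as List
open import Data.List.Relation.Unary.All as All using (All; []; _∷_)
import Data.List.Relation.Unary.All.Properties as All
open import Data.Maybe.Base using (Maybe; just; nothing)
open import Data.Nat.Base as ℕ using (ℕ; zero; suc)
open import Data.Nat.Combinatorics using (_C_; nCk+nC[k+1]≡[n+1]C[k+1]; k>n⇒nCk≡0)
import Data.Nat.ListAction as ℕ
import Data.Nat.Properties as ℕ
open import Data.Product.Base using (Σ-syntax; ∃; ∃-syntax; ∃₂; _×_; _,_; proj₁; proj₂)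
open import Data.Sum.Base as Sum using (_⊎_; inj₁; inj₂)
import Data.Unit.Base as Unit
open import Data.Vec.Base as Vec using ([]; _∷_)
import Data.Vec.Functional as Vector
open import Data.Vec.Functional using (Vector)
import Data.Vec.Functional.Properties as Vector
import Data.Vec.Properties as Vec
open import Function.Base using (_∘_; id; case_of_)
open import Level using (Level; 0ℓ)
open import Relation.Binary.Bundles using (Setoid)
import Relation.Binary.Construct.NonStrictToStrict as ToStrict
open import Relation.Binary.Core using (Rel)
open import Relation.Binary.Definitions using (tri<; tri≈; tri>)
open import Relation.Binary.PropositionalEquality as ≡ using (_≡_; _≢_; module ≡-Reasoning)
open import Relation.Binary.Structures using (IsTotalOrder)
open import Relation.Nullary using (¬_; Dec; yes; no; does; contradiction)
open import Relation.Nullary.Decidable using (¬?; decidable-stable)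
open import Relation.Unary using (Pred; Satisfiable; _⊆_; _∈_; _∉_; _∩_; _∪_)

-- That the cells fill the complement of the atoms needs an argument in both directions. Only ties
-- of codimension 1 are atoms, and a tie may be smaller: for max(x, -x, y, -y) in the plane, x and
-- -x tie at the maximum only at the origin. That tie is no atom, yet atoms of other pairs pass
-- through the origin. In general the required pair is found by following the forms that are maximal
-- at the point along a generic line to the last breakpoint of their maximum. Conversely, a tie that
-- meets a cell contains the whole cell, and an open set does not fit into a set of codimension 1.
-- The indicator of being nonempty obeys linear relations because every nonempty open convex set in
-- ℝⁿ has the same compactly supported Euler characteristic (-1)^n, a constant that cancels.

-- Integer sums over lists, and truth values as integers.

module ListSum where

  ∑ₗ : ∀ {a} {A : Set a} → List A → (A → ℤ) → ℤ
  ∑ₗ []       f = 0ℤ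
  ∑ₗ (x ∷ xs) f = f x ℤ.+ ∑ₗ xs f

  private
    variable
      a b : Level
      A   : Set a
      B   : Set b

  +-interchange : ∀ i j k l → (i ℤ.+ j) ℤ.+ (k ℤ.+ l) ≡ (i ℤ.+ k) ℤ.+ (j ℤ.+ l)
  +-interchange = solve 4 (λ i j k l → (i :+ j) :+ (k :+ l) := (i :+ k) :+ (j :+ l)) ≡.refl
    where open +-*-Solver

  ∑ₗ-cong-All : ∀ {f g : A → ℤ} {xs} → All (λ x → f x ≡ g x) xs → ∑ₗ xs f ≡ ∑ₗ xs g
  ∑ₗ-cong-All []       = ≡.refl
  ∑ₗ-cong-All (p ∷ ps) = ≡.cong₂ ℤ._+_ p (∑ₗ-cong-All ps)

  ∑ₗ-cong : ∀ {f g : A → ℤ} xs → (∀ x → f x ≡ g x) → ∑ₗ xs f ≡ ∑ₗ xs g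
  ∑ₗ-cong xs eq = ∑ₗ-cong-All (All.universal eq xs)

  ∑ₗ-++ : ∀ (f : A → ℤ) xs ys → ∑ₗ (xs ++ ys) f ≡ ∑ₗ xs f ℤ.+ ∑ₗ ys f
  ∑ₗ-++ f []       ys = ≡.sym (ℤ.+-identityˡ _)
  ∑ₗ-++ f (x ∷ xs) ys = ≡.trans (≡.cong (ℤ._+_ (f x)) (∑ₗ-++ f xs ys)) (≡.sym (ℤ.+-assoc (f x) _ _))

  ∑ₗ-map : ∀ (g : A → B) (f : B → ℤ) xs → ∑ₗ (List.map g xs) f ≡ ∑ₗ xs (f ∘ g)
  ∑ₗ-map g f []       = ≡.refl
  ∑ₗ-map g f (x ∷ xs) = ≡.cong (ℤ._+_ (f (g x))) (∑ₗ-map g f xs)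

  ∑ₗ-concatMap : ∀ (g : A → List B) (f : B → ℤ) xs →
                 ∑ₗ (List.concatMap g xs) f ≡ ∑ₗ xs (λ x → ∑ₗ (g x) f)
  ∑ₗ-concatMap g f []       = ≡.refl
  ∑ₗ-concatMap g f (x ∷ xs) = ≡.trans (∑ₗ-++ f (g x) _) (≡.cong (ℤ._+_ (∑ₗ (g x) f)) (∑ₗ-concatMap g f xs))

  ∑ₗ-zero : ∀ (xs : List A) → ∑ₗ xs (λ _ → 0ℤ) ≡ 0ℤ
  ∑ₗ-zero []       = ≡.refl
  ∑ₗ-zero (_ ∷ xs) = ≡.trans (ℤ.+-identityˡ _) (∑ₗ-zero xs)

  ∑ₗ-distrib-+ : ∀ (f g : A → ℤ) xs → ∑ₗ xs (λ x → f x ℤ.+ g x) ≡ ∑ₗ xs f ℤ.+ ∑ₗ xs g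
  ∑ₗ-distrib-+ f g []       = ≡.refl
  ∑ₗ-distrib-+ f g (x ∷ xs) =
    ≡.trans (≡.cong (ℤ._+_ (f x ℤ.+ g x)) (∑ₗ-distrib-+ f g xs)) (+-interchange (f x) (g x) _ _)

  *-distribˡ-∑ₗ : ∀ c (f : A → ℤ) xs → c ℤ.* ∑ₗ xs f ≡ ∑ₗ xs (λ x → c ℤ.* f x)
  *-distribˡ-∑ₗ c f []       = ℤ.*-zeroʳ c
  *-distribˡ-∑ₗ c f (x ∷ xs) =
    ≡.trans (ℤ.*-distribˡ-+ c (f x) _) (≡.cong (ℤ._+_ (c ℤ.* f x)) (*-distribˡ-∑ₗ c f xs))

  𝟙 : ∀ {p} {P : Set p} → Dec P → ℤ
  𝟙 d = if does d then 1ℤ else 0ℤ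

  𝟙-yes : ∀ {p} {P : Set p} (d : Dec P) → P → 𝟙 d ≡ 1ℤ
  𝟙-yes (yes _) _ = ≡.refl
  𝟙-yes (no ¬p) p = contradiction p ¬p

  𝟙-no : ∀ {p} {P : Set p} (d : Dec P) → ¬ P → 𝟙 d ≡ 0ℤ
  𝟙-no (yes p) ¬p = contradiction p ¬p
  𝟙-no (no _)  _  = ≡.refl

  𝟙-cong : ∀ {p q} {P : Set p} {Q : Set q} (d : Dec P) (d′ : Dec Q) →
           (P → Q) → (Q → P) → 𝟙 d ≡ 𝟙 d′
  𝟙-cong (yes p) d′ f g = ≡.sym (𝟙-yes d′ (f p))
  𝟙-cong (no ¬p) d′ f g = ≡.sym (𝟙-no d′ (¬p ∘ g))

open ListSum

-- Alternating binomial sums over subsets.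

module Combinatorics where

  open MonoidSum ℤ.+-0-monoid using (sum⁺-syntax)

  -- e k q = Σ_{u ≥ q} (-1)^u (k choose u)
  e : ℕ → ℕ → ℤ
  e zero    zero    = 1ℤ
  e (suc k) zero    = 0ℤ
  e zero    (suc q) = 0ℤ
  e (suc k) (suc q) = e k (suc q) ℤ.- e k q

  -- Partial alternating sums of a row of Pascal's triangle telescope: in row `suc k` the terms up
  -- to q add up to (-1)^q (k choose q). The whole row adds up to 0, so the tail is the negative of
  -- this.
  e-closed : ∀ k q → e (suc k) (suc q) ≡ ℤ.- (-1ℤ ℤ.^ q ℤ.* + (k C q))
  e-closed zero    zero    = ≡.refl
  e-closed zero    (suc q) = ≡.sym (≡.cong ℤ.-_ (≡.trans
    (≡.cong (λ z → -1ℤ ℤ.^ suc q ℤ.* + z) (k>n⇒nCk≡0 {k = suc q} (ℕ.s≤s ℕ.z≤n))) (ℤ.*-zeroʳ (-1ℤ ℤ.^ suc q))))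
  e-closed (suc k) zero    = ≡.cong (ℤ._- 0ℤ) (e-closed k 0)
  e-closed (suc k) (suc q) = begin
    e (suc k) (suc (suc q)) ℤ.- e (suc k) (suc q)
      ≡⟨ ≡.cong₂ ℤ._-_ (e-closed k (suc q)) (e-closed k q) ⟩
    ℤ.- (-1ℤ ℤ.* s ℤ.* + (k C suc q)) ℤ.- (ℤ.- (s ℤ.* + (k C q)))
      ≡⟨ solve 3 (λ s x y → :- (con -1ℤ :* s :* x) :- (:- (s :* y)) := :- (con -1ℤ :* s :* (y :+ x)))
           ≡.refl s (+ (k C suc q)) (+ (k C q)) ⟩
    ℤ.- (-1ℤ ℤ.* s ℤ.* + (k C q ℕ.+ k C suc q))
      ≡⟨ ≡.cong (λ z → ℤ.- (-1ℤ ℤ.* s ℤ.* + z)) (nCk+nC[k+1]≡[n+1]C[k+1] k q) ⟩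
    ℤ.- (-1ℤ ℤ.* s ℤ.* + (suc k C suc q)) ∎
    where
    open ≡-Reasoning
    open +-*-Solver
    s = -1ℤ ℤ.^ q

  -- This is the sum of (-1)^(|T| - |S|) over all T ⊇ S with |T| ≥ q, grouped by |T| - |S|.
  -- Truncated subtraction is right here: for q ≤ |S| every superset counts.
  weight : ∀ {m} → ℕ → Subset m → ℤ
  weight {m} q S = e (m ℕ.∸ ∣ S ∣) (q ℕ.∸ ∣ S ∣)

  -- A superset T of S either omits the new element, or contains it and then needs one element fewer
  -- from the rest and changes sign.
  weight-outside : ∀ {m} q (S : Subset m) →
                   weight (suc q) (outside ∷ S) ≡ weight (suc q) S ℤ.- weight q S
  weight-outside {m} q S = ≡.trans (≡.cong (λ z → e z (suc q ℕ.∸ ∣ S ∣)) (ℕ.+-∸-assoc 1 (Subset.∣p∣≤n S)))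
    (go (m ℕ.∸ ∣ S ∣) ∣ S ∣)
    where
    go : ∀ k s → e (suc k) (suc q ℕ.∸ s) ≡ e k (suc q ℕ.∸ s) ℤ.- e k (q ℕ.∸ s)
    go k s with s ℕ.≤? q
    ... | yes s≤q rewrite ℕ.+-∸-assoc 1 s≤q = ≡.refl
    -- Beyond q all three terms are full row sums: the left one is 0 and the two on the right
    -- cancel.
    ... | no  s≰q rewrite ℕ.m≤n⇒m∸n≡0 (ℕ.≰⇒> s≰q) | ℕ.m≤n⇒m∸n≡0 (ℕ.<⇒≤ (ℕ.≰⇒> s≰q)) =
      ≡.sym (ℤ.+-inverseʳ (e k 0))

  ∏∈ : ∀ {m} → Subset m → (Fin m → ℤ) → ℤ
  ∏∈ []            g = 1ℤ
  ∏∈ (outside ∷ S) g = ∏∈ S (g ∘ suc)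
  ∏∈ (inside ∷ S)  g = g zero ℤ.* ∏∈ S (g ∘ suc)

  module _ {m} (f : Subset (suc m) → ℤ) where
    ∑ₗ-subsets-suc : ∑ₗ (subsets (suc m)) f ≡
      ∑ₗ (subsets m) (λ S → f (outside ∷ S)) ℤ.+ ∑ₗ (subsets m) (λ S → f (inside ∷ S))
    ∑ₗ-subsets-suc = ≡.trans (∑ₗ-++ f (List.map (outside ∷_) (subsets m)) _)
      (≡.cong₂ ℤ._+_ (∑ₗ-map (outside ∷_) f (subsets m)) (∑ₗ-map (inside ∷_) f (subsets m)))

  -- With `weight` expanded over T, the inner sum of (-1)^|S| runs over the S ⊆ T that avoid B. It
  -- vanishes unless T ⊆ B, which |B| < q ≤ |T| excludes. The induction on m carries this out
  -- without naming T.
  weighted-sum-vanishes :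
    ∀ {m} (B : Subset m) (g : Fin m → ℤ) →
    (∀ i → (i Subset.∈ B × g i ≡ 0ℤ) ⊎ (i Subset.∉ B × g i ≡ 1ℤ)) →
    ∀ q → ∣ B ∣ ℕ.< q → ∑ₗ (subsets m) (λ S → weight q S ℤ.* ∏∈ S g) ≡ 0ℤ
  weighted-sum-vanishes [] g _ (suc q) _ = ≡.refl
  weighted-sum-vanishes {suc m} (b ∷ B) g dich (suc q) ∣B∣<q = begin
    ∑ₗ (subsets (suc m)) (λ S → weight (suc q) S ℤ.* ∏∈ S g)
      ≡⟨ ∑ₗ-subsets-suc (λ S → weight (suc q) S ℤ.* ∏∈ S g) ⟩
    ∑ₗ (subsets m) (λ S → weight (suc q) (outside ∷ S) ℤ.* P S)
      ℤ.+ ∑ₗ (subsets m) (λ S → weight q S ℤ.* (g zero ℤ.* P S))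
      ≡⟨ ∑ₗ-distrib-+ _ _ (subsets m) ⟨
    ∑ₗ (subsets m) (λ S → weight (suc q) (outside ∷ S) ℤ.* P S ℤ.+ weight q S ℤ.* (g zero ℤ.* P S))
      ≡⟨ ∑ₗ-cong (subsets m) (λ S → ≡.trans
           (≡.cong (λ z → z ℤ.* P S ℤ.+ weight q S ℤ.* (g zero ℤ.* P S)) (weight-outside q S))
           (solve 4 (λ u v x p → (u :- v) :* p :+ v :* (x :* p) := u :* p :+ (x :- con 1ℤ) :* (v :* p))
              ≡.refl (weight (suc q) S) (weight q S) (g zero) (P S))) ⟩
    ∑ₗ (subsets m) (λ S → weight (suc q) S ℤ.* P S ℤ.+ (g zero ℤ.- 1ℤ) ℤ.* (weight q S ℤ.* P S))
      ≡⟨ ∑ₗ-distrib-+ _ _ (subsets m) ⟩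
    ∑ₗ (subsets m) (λ S → weight (suc q) S ℤ.* P S)
      ℤ.+ ∑ₗ (subsets m) (λ S → (g zero ℤ.- 1ℤ) ℤ.* (weight q S ℤ.* P S))
      ≡⟨ ≡.cong₂ ℤ._+_ IH (≡.trans (≡.sym (*-distribˡ-∑ₗ (g zero ℤ.- 1ℤ) _ (subsets m))) (second (dich zero))) ⟩
    0ℤ ∎
    where
    open ≡-Reasoning
    open +-*-Solver
    P : Subset m → ℤ
    P S = ∏∈ S (g ∘ suc)
    dich′ : ∀ i → (i Subset.∈ B × g (suc i) ≡ 0ℤ) ⊎ (i Subset.∉ B × g (suc i) ≡ 1ℤ)
    dich′ i with dich (suc i)
    ... | inj₁ (Vec.there i∈B , eq) = inj₁ (i∈B , eq)
    ... | inj₂ (i∉B , eq)           = inj₂ (i∉B ∘ Vec.there , eq)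
    IH : ∑ₗ (subsets m) (λ S → weight (suc q) S ℤ.* P S) ≡ 0ℤ
    IH = weighted-sum-vanishes B (g ∘ suc) dich′ (suc q) (ℕ.≤-<-trans (Subset.∣p∣≤∣x∷p∣ b B) ∣B∣<q)
    -- Off B the factor is 0. On B the head accounts for one element, so the rest of B is still
    -- smaller than q.
    second : (zero Subset.∈ (b ∷ B) × g zero ≡ 0ℤ) ⊎ (zero Subset.∉ (b ∷ B) × g zero ≡ 1ℤ) →
             (g zero ℤ.- 1ℤ) ℤ.* ∑ₗ (subsets m) (λ S → weight q S ℤ.* P S) ≡ 0ℤ
    second (inj₁ (Vec.here , _)) = ≡.trans
      (≡.cong ((g zero ℤ.- 1ℤ) ℤ.*_) (weighted-sum-vanishes B (g ∘ suc) dich′ q (ℕ.s<s⁻¹ ∣B∣<q)))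
      (ℤ.*-zeroʳ (g zero ℤ.- 1ℤ))
    second (inj₂ (_ , g≡1)) rewrite g≡1 = ≡.refl

  δ : ℕ → ℕ → ℤ
  δ s j = 𝟙 (s ℕ.≟ j)

  δ-≡ : ∀ s → δ s s ≡ 1ℤ
  δ-≡ s = 𝟙-yes (s ℕ.≟ s) ≡.refl

  δ-≢ : ∀ {s j} → s ≢ j → δ s j ≡ 0ℤ
  δ-≢ {s} {j} = 𝟙-no (s ℕ.≟ j)

  δ-suc : ∀ s j → δ (suc s) (suc j) ≡ δ s j
  δ-suc s j = 𝟙-cong (suc s ℕ.≟ suc j) (s ℕ.≟ j) ℕ.suc-injective (≡.cong suc)

  open MonoidSum ℤ.+-0-monoid using (sum; sum-cong-≗; sum-replicate-zero)

  open CommutativeMonoidSum ℤ.+-0-commutativeMonoid using (∑-distrib-+)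
  open SemiringSum ℤ.+-*-semiring using (*-distribʳ-sum)

  sum-δ : ∀ {k} (ψ : Fin k → ℤ) i → sum (λ j → ψ j ℤ.* δ (toℕ i) (toℕ j)) ≡ ψ i
  sum-δ {suc k} ψ zero = ≡.trans (≡.cong₂ ℤ._+_ (ℤ.*-identityʳ (ψ zero))
    (≡.trans (sum-cong-≗ {k} (λ j → ℤ.*-zeroʳ (ψ (suc j)))) (sum-replicate-zero k))) (ℤ.+-identityʳ _)
  sum-δ {suc k} ψ (suc i) = ≡.trans (≡.cong₂ ℤ._+_ (ℤ.*-zeroʳ (ψ zero))
    (≡.trans (sum-cong-≗ {k} (λ j → ≡.cong (ψ (suc j) ℤ.*_) (δ-suc (toℕ i) (toℕ j)))) (sum-δ (ψ ∘ suc) i))) (ℤ.+-identityˡ _)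

  sum-δ-≥ : ∀ {k} (ψ : Fin k → ℤ) {s} → k ℕ.≤ s → sum (λ j → ψ j ℤ.* δ s (toℕ j)) ≡ 0ℤ
  sum-δ-≥ {k} ψ k≤s = ≡.trans
    (sum-cong-≗ {k} (λ j → ≡.trans (≡.cong (ψ j ℤ.*_) (δ-≢ (ℕ.>⇒≢ (ℕ.<-≤-trans (Fin.toℕ<n j) k≤s)))) (ℤ.*-zeroʳ (ψ j))))
    (sum-replicate-zero k)

  -- The formula to be proved is indexed by sizes, the weighted relation by subsets; this exchanges
  -- the two orders of summation, with `δ` selecting the size of S.
  sum-by-size : ∀ {m k} (ψ : Fin k → ℤ) (r : Subset m → ℕ) (xs : List (Subset m)) →
    sum (λ j → ψ j ℤ.* + ℕ.sum (List.map r (List.filter (λ S → ∣ S ∣ ℕ.≟ toℕ j) xs)))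
      ≡ ∑ₗ xs (λ S → sum (λ j → ψ j ℤ.* δ ∣ S ∣ (toℕ j)) ℤ.* + r S)
  sum-by-size {k = k} ψ r [] =
    ≡.trans (sum-cong-≗ {k} (λ j → ℤ.*-zeroʳ (ψ j))) (sum-replicate-zero k)
  sum-by-size {k = k} ψ r (S ∷ xs) = begin
    sum (λ j → ψ j ℤ.* R (S ∷ xs) j)
      ≡⟨ sum-cong-≗ {k} (λ j → ≡.trans (≡.cong (ψ j ℤ.*_) (step j))
           (solve 4 (λ p d r s → p :* (d :* r :+ s) := p :* d :* r :+ p :* s) ≡.refl
              (ψ j) (δ ∣ S ∣ (toℕ j)) (+ r S) (R xs j))) ⟩
    sum (λ j → ψ j ℤ.* δ ∣ S ∣ (toℕ j) ℤ.* + r S ℤ.+ ψ j ℤ.* R xs j)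
      ≡⟨ ∑-distrib-+ {k} (λ j → ψ j ℤ.* δ ∣ S ∣ (toℕ j) ℤ.* + r S) (λ j → ψ j ℤ.* R xs j) ⟩
    sum (λ j → ψ j ℤ.* δ ∣ S ∣ (toℕ j) ℤ.* + r S) ℤ.+ sum (λ j → ψ j ℤ.* R xs j)
      ≡⟨ ≡.cong₂ ℤ._+_ (≡.sym (*-distribʳ-sum {k} (+ r S) (λ j → ψ j ℤ.* δ ∣ S ∣ (toℕ j)))) (sum-by-size ψ r xs) ⟩
    ∑ₗ (S ∷ xs) (λ S → sum (λ j → ψ j ℤ.* δ ∣ S ∣ (toℕ j)) ℤ.* + r S) ∎
    where
    open ≡-Reasoning
    open +-*-Solver
    R : List (Subset _) → Fin k → ℤ
    R xs j = + ℕ.sum (List.map r (List.filter (λ S → ∣ S ∣ ℕ.≟ toℕ j) xs))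
    step : ∀ j → R (S ∷ xs) j ≡ δ ∣ S ∣ (toℕ j) ℤ.* + r S ℤ.+ R xs j
    step j = case ∣ S ∣ ℕ.≟ toℕ j of λ where
      (yes eq) → ≡.trans
        (≡.cong (λ ys → + ℕ.sum (List.map r ys)) (List.filter-accept (λ S → ∣ S ∣ ℕ.≟ toℕ j) {x = S} {xs = xs} eq))
        (≡.cong (ℤ._+ R xs j) (≡.sym (≡.trans
          (≡.cong (ℤ._* + r S) (𝟙-yes (∣ S ∣ ℕ.≟ toℕ j) eq)) (ℤ.*-identityˡ (+ r S)))))
      (no neq) → ≡.trans
        (≡.cong (λ ys → + ℕ.sum (List.map r ys)) (List.filter-reject (λ S → ∣ S ∣ ℕ.≟ toℕ j) {x = S} {xs = xs} neq))
        (≡.sym (≡.trans (≡.cong (λ z → z ℤ.* + r S ℤ.+ R xs j) (δ-≢ neq)) (ℤ.+-identityˡ _)))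

  sum-δ-full : ∀ {m} (f : Subset m → ℤ) →
               ∑ₗ (subsets m) (λ S → δ ∣ S ∣ m ℤ.* f S) ≡ f Subset.⊤
  sum-δ-full {zero}  f = ≡.trans (ℤ.+-identityʳ _) (ℤ.*-identityˡ (f []))
  sum-δ-full {suc m} f = begin
    ∑ₗ (subsets (suc m)) (λ S → δ ∣ S ∣ (suc m) ℤ.* f S)
      ≡⟨ ∑ₗ-subsets-suc (λ S → δ ∣ S ∣ (suc m) ℤ.* f S) ⟩
    ∑ₗ (subsets m) (λ S → δ ∣ S ∣ (suc m) ℤ.* f (outside ∷ S))
      ℤ.+ ∑ₗ (subsets m) (λ S → δ (suc ∣ S ∣) (suc m) ℤ.* f (inside ∷ S))
      ≡⟨ ≡.cong₂ ℤ._+_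
           (≡.trans (∑ₗ-cong (subsets m) λ S → ≡.trans
              (≡.cong (ℤ._* f (outside ∷ S)) (δ-≢ (ℕ.<⇒≢ (ℕ.s≤s (Subset.∣p∣≤n S)))))
              (ℤ.*-zeroˡ (f (outside ∷ S)))) (∑ₗ-zero (subsets m)))
           (≡.trans (∑ₗ-cong (subsets m) λ S → ≡.cong (ℤ._* f (inside ∷ S)) (δ-suc ∣ S ∣ m)) (sum-δ-full (f ∘ (inside ∷_)))) ⟩
    0ℤ ℤ.+ f (inside ∷ Subset.⊤)
      ≡⟨ ℤ.+-identityˡ _ ⟩
    f Subset.⊤ ∎
    where
    open ≡-Reasoning

  coefficient : ℕ → ℕ → ℕ → ℤ
  coefficient n m j = -1ℤ ℤ.^ (n ℕ.∸ j) ℤ.* + ((m ℕ.∸ 1 ℕ.∸ j) C (n ℕ.∸ j))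

  module _ {n m : ℕ} (n<m : n ℕ.< m) where

    -- There are three ranges of |S|. Up to n, `n<m` makes `m ∸ |S|` a successor and `e-closed`
    -- gives minus the coefficient. Strictly between n and m the weight is a full alternating row
    -- sum, hence 0. At |S| = m the row has the single entry 1.
    weight-formula : ∀ (S : Subset m) →
      δ ∣ S ∣ m ≡ weight (suc n) S ℤ.+ sum {suc n} (λ j → coefficient n m (toℕ j) ℤ.* δ ∣ S ∣ (toℕ j))
    weight-formula S with ∣ S ∣ ℕ.≤? n
    ... | yes s≤n = ≡.sym (begin
      weight (suc n) S ℤ.+ sum {suc n} (λ j → coefficient n m (toℕ j) ℤ.* δ s (toℕ j))
        ≡⟨ ≡.cong₂ ℤ._+_ weight≡ (≡.trans
             (≡.cong (λ z → sum {suc n} (λ j → coefficient n m (toℕ j) ℤ.* δ z (toℕ j))) (≡.sym toℕ-s))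
             (≡.trans (sum-δ (coefficient n m ∘ toℕ) (Fin.fromℕ< (ℕ.s≤s s≤n))) (≡.cong (coefficient n m) toℕ-s))) ⟩
      ℤ.- coefficient n m s ℤ.+ coefficient n m s
        ≡⟨ ℤ.+-inverseˡ (coefficient n m s) ⟩
      0ℤ
        ≡⟨ δ-≢ (ℕ.<⇒≢ (ℕ.≤-<-trans s≤n n<m)) ⟨
      δ s m ∎)
      where
      open ≡-Reasoning
      s = ∣ S ∣
      toℕ-s = Fin.toℕ-fromℕ< (ℕ.s≤s s≤n)
      weight≡ : weight (suc n) S ≡ ℤ.- coefficient n m s
      weight≡ = ≡.trans (≡.cong₂ e m∸s (ℕ.+-∸-assoc 1 s≤n)) (e-closed (m ℕ.∸ 1 ℕ.∸ s) (n ℕ.∸ s))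
        where
        m∸s : m ℕ.∸ s ≡ suc (m ℕ.∸ 1 ℕ.∸ s)
        m∸s = ≡.trans (ℕ.+-∸-assoc 1 {m} {suc s} (ℕ.≤-<-trans s≤n n<m)) (≡.cong suc (≡.sym (ℕ.∸-+-assoc m 1 s)))
    ... | no s≰n = ≡.sym (≡.trans
      (≡.cong₂ ℤ._+_ (≡.cong (e (m ℕ.∸ s)) (ℕ.m≤n⇒m∸n≡0 (ℕ.≰⇒> s≰n)))
                     (sum-δ-≥ (coefficient n m ∘ toℕ) (ℕ.≰⇒> s≰n)))
      (≡.trans (ℤ.+-identityʳ _) last))
      where
      s = ∣ S ∣
      last : e (m ℕ.∸ s) 0 ≡ δ s m
      last with s ℕ.≟ m
      ... | yes eq rewrite eq | ℕ.n∸n≡0 m = ≡.sym (δ-≡ m)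
      ... | no neq = ≡.trans (≡.cong (λ z → e z 0) (ℕ.+-∸-assoc 1 {m} {suc s} (ℕ.≤∧≢⇒< (Subset.∣p∣≤n S) neq)))
        (≡.sym (δ-≢ neq))

    solve-for-⊤ : (r : Subset m → ℕ) → ∑ₗ (subsets m) (λ S → weight (suc n) S ℤ.* + r S) ≡ 0ℤ →
      + r Subset.⊤ ≡ sum⁺-syntax n (λ j →
        -1ℤ ℤ.^ (n ℕ.∸ toℕ j) ℤ.* + ((m ℕ.∸ 1 ℕ.∸ toℕ j) C (n ℕ.∸ toℕ j))
          ℤ.* + ℕ.sum (List.map r (subsetsOfSize m (toℕ j))))
    solve-for-⊤ r eq = begin
      + r Subset.⊤
        ≡⟨ sum-δ-full (λ S → + r S) ⟨
      ∑ₗ (subsets m) (λ S → δ ∣ S ∣ m ℤ.* + r S)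
        ≡⟨ ∑ₗ-cong (subsets m) (λ S → ≡.trans (≡.cong (ℤ._* + r S) (weight-formula S))
             (ℤ.*-distribʳ-+ (+ r S) (weight (suc n) S) (c S))) ⟩
      ∑ₗ (subsets m) (λ S → weight (suc n) S ℤ.* + r S ℤ.+ c S ℤ.* + r S)
        ≡⟨ ∑ₗ-distrib-+ _ _ (subsets m) ⟩
      ∑ₗ (subsets m) (λ S → weight (suc n) S ℤ.* + r S) ℤ.+ ∑ₗ (subsets m) (λ S → c S ℤ.* + r S)
        ≡⟨ ≡.cong (ℤ._+ ∑ₗ (subsets m) (λ S → c S ℤ.* + r S)) eq ⟩
      0ℤ ℤ.+ ∑ₗ (subsets m) (λ S → c S ℤ.* + r S)
        ≡⟨ ℤ.+-identityˡ _ ⟩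
      ∑ₗ (subsets m) (λ S → c S ℤ.* + r S)
        ≡⟨ sum-by-size {k = suc n} (coefficient n m ∘ toℕ) r (subsets m) ⟨
      sum⁺-syntax n (λ j → coefficient n m (toℕ j) ℤ.* + ℕ.sum (List.map r (subsetsOfSize m (toℕ j)))) ∎
      where
      open ≡-Reasoning
      c : Subset m → ℤ
      c S = sum {suc n} (λ j → coefficient n m (toℕ j) ℤ.* δ ∣ S ∣ (toℕ j))

open Combinatorics

module Geometry (em : ∀ ℓ → ExcludedMiddle ℓ) (ℛ : RealNumbers) where

  open RealNumbers ℛ renaming (zero to *-zero)

  -- Ordered field arithmetic and sufficiently small positive numbers.

  module OrderedField where

    module ≤ = IsTotalOrder isTotalOrder

    -- Equality of reals does not compute, so the solver takes its coefficients in ℤ, where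
    -- constants can be compared, and carries them over by the homomorphism from ℤ.
    module Ring-Solver where

      open import Algebra.Properties.Semiring.Mult.TCOptimised semiring
        using (1+×; ×-homo-+; ×1-homo-*) renaming (_×_ to _ℕ×_)
      open import Algebra.Properties.Ring ring
        using (-0#≈0#; -‿involutive; -‿distribˡ-*; -‿distribʳ-*; -‿+-comm)
      open import Relation.Binary.Reasoning.Setoid setoid

      ⟦_⟧ : ℤ → Carrier
      ⟦ + n ⟧        = n ℕ× 1#
      ⟦ ℤ.-[1+ n ] ⟧ = - (suc n ℕ× 1#)

      ⊖-homo : ∀ m n → ⟦ m ℤ.⊖ n ⟧ ≈ m ℕ× 1# - n ℕ× 1#
      ⊖-homo m       zero    = sym (trans (+-congˡ -0#≈0#) (+-identityʳ _))
      ⊖-homo zero    (suc n) = sym (+-identityˡ _)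
      ⊖-homo (suc m) (suc n) = begin
        ⟦ suc m ℤ.⊖ suc n ⟧              ≡⟨ ≡.cong ⟦_⟧ (ℤ.[1+m]⊖[1+n]≡m⊖n m n) ⟩
        ⟦ m ℤ.⊖ n ⟧                      ≈⟨ ⊖-homo m n ⟩
        M - N                            ≈⟨ +-congʳ (+-identityˡ M) ⟨
        (0# + M) - N                     ≈⟨ +-congʳ (+-congʳ (-‿inverseʳ 1#)) ⟨
        (1# - 1# + M) - N                ≈⟨ +-congʳ (trans (+-assoc _ _ _) (trans (+-congˡ (+-comm _ _)) (sym (+-assoc _ _ _)))) ⟩
        (1# + M - 1#) - N                ≈⟨ +-assoc _ _ _ ⟩
        (1# + M) + (- 1# - N)            ≈⟨ +-congˡ (-‿+-comm 1# N) ⟩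
        (1# + M) - (1# + N)              ≈⟨ +-cong (1+× m 1#) (-‿cong (1+× n 1#)) ⟨
        suc m ℕ× 1# - suc n ℕ× 1#        ∎
        where
        M = m ℕ× 1#
        N = n ℕ× 1#

      -‿homo : ∀ i → ⟦ ℤ.- i ⟧ ≈ - ⟦ i ⟧
      -‿homo (+ zero)       = sym -0#≈0#
      -‿homo (+ suc n)      = refl
      -‿homo ℤ.-[1+ n ]     = sym (-‿involutive _)

      +-homo : ∀ i j → ⟦ i ℤ.+ j ⟧ ≈ ⟦ i ⟧ + ⟦ j ⟧
      +-homo (+ m)      (+ n)      = ×-homo-+ 1# m n
      +-homo (+ m)      ℤ.-[1+ n ] = ⊖-homo m (suc n)
      +-homo ℤ.-[1+ m ] (+ n)      = trans (⊖-homo n (suc m)) (+-comm _ _)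
      +-homo ℤ.-[1+ m ] ℤ.-[1+ n ] = begin
        - (suc (suc (m ℕ.+ n)) ℕ× 1#)      ≡⟨ ≡.cong (λ k → - (suc k ℕ× 1#)) (ℕ.+-suc m n) ⟨
        - ((suc m ℕ.+ suc n) ℕ× 1#)        ≈⟨ -‿cong (×-homo-+ 1# (suc m) (suc n)) ⟩
        - (suc m ℕ× 1# + suc n ℕ× 1#)      ≈⟨ -‿+-comm _ _ ⟨
        - (suc m ℕ× 1#) - (suc n ℕ× 1#)    ∎

      *-homo⁺ : ∀ m n → ⟦ + m ℤ.* + n ⟧ ≈ ⟦ + m ⟧ * ⟦ + n ⟧
      *-homo⁺ m n = trans (reflexive (≡.cong ⟦_⟧ (≡.sym (ℤ.pos-* m n)))) (×1-homo-* m n)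

      *-homoʳ : ∀ m j → ⟦ + m ℤ.* j ⟧ ≈ ⟦ + m ⟧ * ⟦ j ⟧
      *-homoʳ m (+ n)      = *-homo⁺ m n
      *-homoʳ m ℤ.-[1+ n ] = begin
        ⟦ + m ℤ.* ℤ.- (+ suc n) ⟧    ≡⟨ ≡.cong ⟦_⟧ (ℤ.neg-distribʳ-* (+ m) (+ suc n)) ⟨
        ⟦ ℤ.- (+ m ℤ.* + suc n) ⟧    ≈⟨ -‿homo (+ m ℤ.* + suc n) ⟩
        - ⟦ + m ℤ.* + suc n ⟧        ≈⟨ -‿cong (*-homo⁺ m (suc n)) ⟩
        - (⟦ + m ⟧ * ⟦ + suc n ⟧)    ≈⟨ -‿distribʳ-* _ _ ⟩
        ⟦ + m ⟧ * - ⟦ + suc n ⟧      ∎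

      *-homo : ∀ i j → ⟦ i ℤ.* j ⟧ ≈ ⟦ i ⟧ * ⟦ j ⟧
      *-homo (+ m)      j = *-homoʳ m j
      *-homo ℤ.-[1+ m ] j = begin
        ⟦ ℤ.- (+ suc m) ℤ.* j ⟧      ≡⟨ ≡.cong ⟦_⟧ (ℤ.neg-distribˡ-* (+ suc m) j) ⟨
        ⟦ ℤ.- (+ suc m ℤ.* j) ⟧      ≈⟨ -‿homo (+ suc m ℤ.* j) ⟩
        - ⟦ + suc m ℤ.* j ⟧          ≈⟨ -‿cong (*-homoʳ (suc m) j) ⟩
        - (⟦ + suc m ⟧ * ⟦ j ⟧)      ≈⟨ -‿distribˡ-* _ _ ⟩
        - ⟦ + suc m ⟧ * ⟦ j ⟧        ∎

      coefficient≟ : ∀ i j → Maybe (⟦ i ⟧ ≈ ⟦ j ⟧)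
      coefficient≟ i j with i ℤ.≟ j
      ... | yes ≡.refl = just refl
      ... | no _       = nothing

      morphism : ℤ.+-*-rawRing -Raw-AlmostCommutative⟶ fromCommutativeRing commutativeRing
      morphism = record
        { ⟦_⟧ = ⟦_⟧ ; +-homo = +-homo ; *-homo = *-homo ; -‿homo = -‿homo
        ; 0-homo = refl ; 1-homo = refl }

      open RingSolver ℤ.+-*-rawRing (fromCommutativeRing commutativeRing) morphism coefficient≟ public
        using (solve; _:=_; _:+_; _:*_; _:-_; :-_; con)

    open Ring-Solver using (solve; _:=_; _:+_; _:*_; _:-_; :-_; con) public

    _≈?_ : ∀ x y → Dec (x ≈ y)
    x ≈? y = em 0ℓ

    <⇒≉ : ∀ {x y} → x < y → ¬ y ≈ x
    <⇒≉ (_ , x≉y) y≈x = x≉y (sym y≈x)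

    <-irrefl : ∀ {x y} → x ≈ y → ¬ x < y
    <-irrefl x≈y (_ , x≉y) = x≉y x≈y

    ≤⇒≯ : ∀ {x y} → x ≤ y → ¬ y < x
    ≤⇒≯ = ToStrict.≤⇒≯ _≈_ _≤_ ≤.antisym

    ≰⇒> : ∀ {x y} → ¬ x ≤ y → y < x
    ≰⇒> = ToStrict.≰⇒> _≈_ _≤_ sym ≤.reflexive ≤.total

    ≮⇒≥ : ∀ {x y} → ¬ x < y → y ≤ x
    ≮⇒≥ = ToStrict.≮⇒≥ _≈_ _≤_ sym _≈?_ ≤.reflexive ≤.total

    <-≤-trans : ∀ {x y z} → x < y → y ≤ z → x < z
    <-≤-trans = ToStrict.<-≤-trans _≈_ _≤_ sym ≤.trans ≤.antisym ≤.≤-respʳ-≈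

    ≤-<-trans : ∀ {x y z} → x ≤ y → y < z → x < z
    ≤-<-trans = ToStrict.≤-<-trans _≈_ _≤_ ≤.trans ≤.antisym ≤.≤-respˡ-≈

    <-resp-≈ : ∀ {x x′ y y′} → x ≈ x′ → y ≈ y′ → x < y → x′ < y′
    <-resp-≈ x≈x′ y≈y′ x<y = ≤-<-trans (≤.reflexive (sym x≈x′)) (<-≤-trans x<y (≤.reflexive y≈y′))

    ≤-resp-≈ : ∀ {x x′ y y′} → x ≈ x′ → y ≈ y′ → x ≤ y → x′ ≤ y′
    ≤-resp-≈ x≈x′ y≈y′ x≤y = ≤.trans (≤.reflexive (sym x≈x′)) (≤.trans x≤y (≤.reflexive y≈y′))

    x-y≈0⇒x≈y : ∀ {x y} → x - y ≈ 0# → x ≈ y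
    x-y≈0⇒x≈y {x} {y} = x∙y⁻¹≈ε⇒x≈y x y
      where open import Algebra.Properties.Group +-group using (x∙y⁻¹≈ε⇒x≈y)

    x≈y⇒x-y≈0 : ∀ {x y} → x ≈ y → x - y ≈ 0#
    x≈y⇒x-y≈0 {y = y} x≈y = trans (+-congʳ x≈y) (-‿inverseʳ y)

    ≤⇒0≤- : ∀ {x y} → x ≤ y → 0# ≤ y - x
    ≤⇒0≤- {x} x≤y = ≤-resp-≈ (-‿inverseʳ x) refl (+-monoˡ-≤ (- x) x≤y)

    0≤-⇒≤ : ∀ {x y} → 0# ≤ y - x → x ≤ y
    0≤-⇒≤ {x} {y} 0≤ = ≤-resp-≈ (+-identityˡ x) (solve 2 (λ x y → y :- x :+ x := y) refl x y) (+-monoˡ-≤ x 0≤)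

    <⇒0<- : ∀ {x y} → x < y → 0# < y - x
    <⇒0<- (x≤y , x≉y) = ≤⇒0≤- x≤y , λ eq → x≉y (sym (x-y≈0⇒x≈y (sym eq)))

    0<-⇒< : ∀ {x y} → 0# < y - x → x < y
    0<-⇒< (0≤ , 0≉) = 0≤-⇒≤ 0≤ , λ eq → 0≉ (sym (x≈y⇒x-y≈0 (sym eq)))

    <-by : ∀ {x y d} → 0# < d → d ≈ y - x → x < y
    <-by 0<d eq = 0<-⇒< (<-resp-≈ refl eq 0<d)

    ≤-by : ∀ {x y d} → 0# ≤ d → d ≈ y - x → x ≤ y
    ≤-by 0≤d eq = 0≤-⇒≤ (≤-resp-≈ refl eq 0≤d)

    +-nonneg : ∀ {x y} → 0# ≤ x → 0# ≤ y → 0# ≤ x + y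
    +-nonneg {x} {y} 0≤x 0≤y = ≤.trans 0≤y (≤-resp-≈ (+-identityˡ y) refl (+-monoˡ-≤ y 0≤x))

    +-pos-nonneg : ∀ {x y} → 0# < x → 0# ≤ y → 0# < x + y
    +-pos-nonneg {x} {y} 0<x 0≤y = <-≤-trans 0<x (≤-by 0≤y (solve 2 (λ x y → y := x :+ y :- x) refl x y))

    *-cancel-0 : ∀ {x y} → ¬ x ≈ 0# → x * y ≈ 0# → y ≈ 0#
    *-cancel-0 {x} {y} x≉0 xy≈0 with invertible x x≉0
    ... | x⁻¹ , xx⁻¹≈1 = begin
      y              ≈⟨ *-identityˡ y ⟨
      1# * y         ≈⟨ *-congʳ xx⁻¹≈1 ⟨
      x * x⁻¹ * y    ≈⟨ solve 3 (λ x y z → x :* z :* y := z :* (x :* y)) refl x y x⁻¹ ⟩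
      x⁻¹ * (x * y)  ≈⟨ *-congˡ xy≈0 ⟩
      x⁻¹ * 0#       ≈⟨ zeroʳ x⁻¹ ⟩
      0#             ∎
      where open import Relation.Binary.Reasoning.Setoid setoid

    *-nonzero : ∀ {x y} → ¬ x ≈ 0# → ¬ y ≈ 0# → ¬ x * y ≈ 0#
    *-nonzero x≉0 y≉0 = y≉0 ∘ *-cancel-0 x≉0

    *-pos : ∀ {x y} → 0# < x → 0# < y → 0# < x * y
    *-pos (0≤x , 0≉x) (0≤y , 0≉y) =
      *-nonneg 0≤x 0≤y , *-nonzero (0≉x ∘ sym) (0≉y ∘ sym) ∘ sym

    -- The inverse, with junk value 0 at 0.
    inv : Carrier → Carrier
    inv x = inv? (x ≈? 0#)
      where
      inv? : Dec (x ≈ 0#) → Carrier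
      inv? (yes _)  = 0#
      inv? (no x≉0) = proj₁ (invertible x x≉0)

    *-inv : ∀ {x} → ¬ x ≈ 0# → x * inv x ≈ 1#
    *-inv {x} x≉0 with x ≈? 0#
    ... | yes x≈0  = contradiction x≈0 x≉0
    ... | no  x≉0′ = proj₂ (invertible x x≉0′)

    neg⇒0≤- : ∀ {x} → x ≤ 0# → 0# ≤ - x
    neg⇒0≤- {x} x≤0 = ≤-resp-≈ refl (+-identityˡ (- x)) (≤⇒0≤- x≤0)

    0<1 : 0# < 1#
    0<1 with ≤.total 0# 1#
    ... | inj₁ 0≤1 = 0≤1 , 0≉1
    ... | inj₂ 1≤0 = contradiction
      (≤.antisym (≤-resp-≈ refl (solve 0 (:- con 1ℤ :* :- con 1ℤ := con 1ℤ) refl) (*-nonneg (neg⇒0≤- 1≤0) (neg⇒0≤- 1≤0))) 1≤0) 0≉1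

    inverse-pos : ∀ {x} → 0# < x → ∃[ y ] 0# < y × x * y ≈ 1#
    inverse-pos {x} 0<x with invertible x (<⇒≉ 0<x)
    ... | y , xy≈1 with ≤.total 0# y
    ...   | inj₁ 0≤y = y , (0≤y , λ 0≈y → 0≉1 (trans (sym (zeroʳ x)) (trans (*-congˡ 0≈y) xy≈1))) , xy≈1
    ...   | inj₂ y≤0 = contradiction (≤-by (≤-resp-≈ refl eq (*-nonneg (proj₁ 0<x) (neg⇒0≤- y≤0))) refl) (λ 1≤0 → ≤⇒≯ 1≤0 0<1)
      where
      eq : x * - y ≈ 0# - 1#
      eq = trans (solve 2 (λ x y → x :* :- y := con 0ℤ :- x :* y) refl x y) (+-congˡ (-‿cong xy≈1))

    -- A property of small positive reals: these form a filter, which replaces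
    -- explicit choices of ε in all perturbation arguments.
    Small : ∀ {ℓ} → Pred Carrier ℓ → Set ℓ
    Small P = ∃[ ε ] 0# < ε × (∀ δ → 0# < δ → δ ≤ ε → P δ)

    small-pure : ∀ {p} {P : Pred Carrier p} → (∀ δ → 0# < δ → P δ) → Small P
    small-pure p = 1# , 0<1 , λ δ 0<δ _ → p δ 0<δ

    small-map : ∀ {p q} {P : Pred Carrier p} {Q : Pred Carrier q} → (∀ δ → 0# < δ → P δ → Q δ) → Small P → Small Q
    small-map f (ε , 0<ε , p) = ε , 0<ε , λ δ 0<δ δ≤ε → f δ 0<δ (p δ 0<δ δ≤ε)

    small-× : ∀ {p q} {P : Pred Carrier p} {Q : Pred Carrier q} → Small P → Small Q → Small (P ∩ Q)
    small-× (ε , 0<ε , p) (ε′ , 0<ε′ , q) with ≤.total ε ε′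
    ... | inj₁ ε≤ε′ = ε , 0<ε , λ δ 0<δ δ≤ε → p δ 0<δ δ≤ε , q δ 0<δ (≤.trans δ≤ε ε≤ε′)
    ... | inj₂ ε′≤ε = ε′ , 0<ε′ , λ δ 0<δ δ≤ε → p δ 0<δ (≤.trans δ≤ε ε′≤ε) , q δ 0<δ δ≤ε

    small-∀ : ∀ {k p} {P : Fin k → Pred Carrier p} → (∀ i → Small (P i)) → Small (λ δ → ∀ i → P i δ)
    small-∀ {zero}  p = small-pure (λ δ _ ())
    small-∀ {suc k} p = small-map (λ where δ _ (q , qs) zero → q
                                           δ _ (q , qs) (suc i) → qs i)
                                  (small-× (p zero) (small-∀ (p ∘ suc)))

    small-All : ∀ {a p} {A : Set a} {P : A → Pred Carrier p} {xs} → All (λ x → Small (P x)) xs →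
                Small (λ δ → All (λ x → P x δ) xs)
    small-All []       = small-pure (λ _ _ → [])
    small-All (p ∷ ps) = small-map (λ _ _ (q , qs) → q ∷ qs) (small-× p (small-All ps))

    small-witness : ∀ {p} {P : Pred Carrier p} → Small P → ∃[ δ ] 0# < δ × P δ
    small-witness (ε , 0<ε , p) = ε , 0<ε , p ε 0<ε ≤.refl

    small-≤ : ∀ {x} → 0# < x → Small (_≤ x)
    small-≤ {x} 0<x = x , 0<x , λ δ _ δ≤x → δ≤x

    small-+* : ∀ {g} → 0# < g → ∀ h → Small (λ δ → 0# < g + δ * h)
    small-+* {g} 0<g h with ≤.total 0# h
    ... | inj₁ 0≤h = small-pure (λ δ 0<δ → +-pos-nonneg 0<g (*-nonneg (proj₁ 0<δ) 0≤h))
    ... | inj₂ h≤0 with inverse-pos {1# - h} (+-pos-nonneg 0<1 (neg⇒0≤- h≤0))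
    -- The bound is g/(1 - h), where the 1 keeps the denominator positive at h = 0. Positivity is
    -- read off from g + δh = δ + (1 - h)(g/(1 - h) - δ).
    ...   | k , 0<k , [1-h]k≈1 = g * k , *-pos 0<g 0<k , λ δ 0<δ δ≤gk →
      <-resp-≈ refl
        (begin
          δ + (1# - h) * (g * k - δ)
            ≈⟨ solve 4 (λ δ h g k → δ :+ (con 1ℤ :- h) :* (g :* k :- δ) := (con 1ℤ :- h) :* k :* g :+ δ :* h) refl δ h g k ⟩
          (1# - h) * k * g + δ * h
            ≈⟨ +-congʳ (trans (*-congʳ [1-h]k≈1) (*-identityˡ g)) ⟩
          g + δ * h ∎)
        (+-pos-nonneg 0<δ (*-nonneg (+-nonneg (proj₁ 0<1) (neg⇒0≤- h≤0)) (≤⇒0≤- δ≤gk)))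
      where open import Relation.Binary.Reasoning.Setoid setoid

    small-≉ : ∀ {g} → ¬ g ≈ 0# → ∀ h → Small (λ δ → ¬ g + δ * h ≈ 0#)
    small-≉ {g} g≉0 h with ≤.total 0# g
    ... | inj₁ 0≤g = small-map (λ δ _ → <⇒≉) (small-+* (0≤g , g≉0 ∘ sym) h)
    ... | inj₂ g≤0 = small-map
      (λ δ _ 0< eq → <⇒≉ 0< (begin
         - g + δ * - h    ≈⟨ solve 3 (λ g δ h → :- g :+ δ :* :- h := :- (g :+ δ :* h)) refl g δ h ⟩
         - (g + δ * h)    ≈⟨ -‿cong eq ⟩
         - 0#             ≈⟨ solve 0 (:- con 0ℤ := con 0ℤ) refl ⟩
         0#               ∎))
      (small-+* (neg⇒0≤- g≤0 , λ 0≈-g → g≉0 (begin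
         g        ≈⟨ solve 1 (λ g → g := :- (:- g)) refl g ⟩
         - - g    ≈⟨ -‿cong 0≈-g ⟨
         - 0#     ≈⟨ solve 0 (:- con 0ℤ := con 0ℤ) refl ⟩
         0#       ∎)) (- h))
      where open import Relation.Binary.Reasoning.Setoid setoid

    -- The restriction to `P` serves the envelope argument, which maximises over active or rival
    -- pieces only.
    argmax : ∀ {k} (P : Fin k → Set) (f : Fin k → Carrier) → ∃ P →
             ∃[ a ] P a × (∀ c → P c → f c ≤ f a)
    argmax {suc k} P f ∃P with em 0ℓ {∃ (P ∘ suc)} | em 0ℓ {P zero}
    ... | no ¬tail | yes P0 = zero , P0 , λ where
            zero    _ → ≤.refl
            (suc c) p → contradiction (c , p) ¬tail
    ... | no ¬tail | no ¬P0 = ⊥-elim (Sum.[ ¬P0 , ¬tail ]′ (Fin.∃-toSum ∃P))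
    ... | yes tail | P0? with argmax (P ∘ suc) (f ∘ suc) tail | P0?
    ...   | a , Pa , max | no ¬P0 = suc a , Pa , λ where
              zero    p → contradiction p ¬P0
              (suc c) p → max c p
    ...   | a , Pa , max | yes P0 with ≤.total (f zero) (f (suc a))
    ...     | inj₁ f0≤ = suc a , Pa , λ where
                zero    _ → f0≤
                (suc c) p → max c p
    ...     | inj₂ f0≥ = zero , P0 , λ where
                zero    _ → ≤.refl
                (suc c) p → ≤.trans (max c p) f0≥

  open OrderedField

  -- Vectors, dot products and affine functions.

  module Affine where

    open import Relation.Binary.Reasoning.Setoid setoid

    open MonoidSum +-monoid public using (sum-replicate-zero) renaming (sum-cong-≋ to sum-cong)
    open CommutativeMonoidSum +-commutativeMonoid public using (sum-remove; ∑-distrib-+; ∑-comm)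
    open SemiringSum semiring public using (*-distribˡ-sum; *-distribʳ-sum)

    sum-zero : ∀ {n} {f : Vector Carrier n} → (∀ t → f t ≈ 0#) → sum f ≈ 0#
    sum-zero {n} f≈0 = trans (sum-cong f≈0) (sum-replicate-zero n)

    sum-linear : ∀ {n} a b (f g : Vector Carrier n) →
                 ∑[ t < n ] (a * f t + b * g t) ≈ a * sum f + b * sum g
    sum-linear a b f g = trans (∑-distrib-+ (λ t → a * f t) (λ t → b * g t))
      (sym (+-cong (*-distribˡ-sum a f) (*-distribˡ-sum b g)))

    _≋_ : ∀ {n} → Rel (Vector Carrier n) 0ℓ
    x ≋ y = ∀ t → x t ≈ y t

    infix 4 _≋_
    infixr 6 _⊹_∙_

    _⊹_∙_ : ∀ {n} → Vector Carrier n → Carrier → Vector Carrier n → Vector Carrier n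
    (x ⊹ c ∙ y) t = x t + c * y t

    _⊖_ : ∀ {n} → Vector Carrier n → Vector Carrier n → Vector Carrier n
    (x ⊖ y) t = x t - y t

    dot : ∀ {n} → Vector Carrier n → Vector Carrier n → Carrier
    dot {n} s x = ∑[ t < n ] (s t * x t)

    dot-congʳ : ∀ {n} (s : Vector Carrier n) {x y} → x ≋ y → dot s x ≈ dot s y
    dot-congʳ s x≋y = sum-cong (λ t → *-congˡ (x≋y t))

    dot-congˡ : ∀ {n} {s s′ : Vector Carrier n} x → s ≋ s′ → dot s x ≈ dot s′ x
    dot-congˡ x s≋s′ = sum-cong (λ t → *-congʳ (s≋s′ t))

    dot-comm : ∀ {n} (s x : Vector Carrier n) → dot s x ≈ dot x s
    dot-comm s x = sum-cong (λ t → *-comm (s t) (x t))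

    dot-linearˡ : ∀ {n} a b (s s′ x : Vector Carrier n) →
                  dot (λ t → a * s t + b * s′ t) x ≈ a * dot s x + b * dot s′ x
    dot-linearˡ a b s s′ x = trans
      (sum-cong (λ t → solve 5 (λ a b s s′ x → (a :* s :+ b :* s′) :* x := a :* (s :* x) :+ b :* (s′ :* x))
         refl a b (s t) (s′ t) (x t)))
      (sum-linear a b (λ t → s t * x t) (λ t → s′ t * x t))

    dot-⊖ : ∀ {n} (s s′ x : Vector Carrier n) → dot (s ⊖ s′) x ≈ dot s x - dot s′ x
    dot-⊖ s s′ x = begin
      dot (s ⊖ s′) x                          ≈⟨ dot-congˡ x (λ t →
        solve 2 (λ a b → a :- b := con 1ℤ :* a :+ :- con 1ℤ :* b) refl (s t) (s′ t)) ⟩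
      dot (λ t → 1# * s t + - 1# * s′ t) x    ≈⟨ dot-linearˡ 1# (- 1#) s s′ x ⟩
      1# * dot s x + - 1# * dot s′ x          ≈⟨ solve 2 (λ a b → con 1ℤ :* a :+ :- con 1ℤ :* b := a :- b) refl (dot s x) (dot s′ x) ⟩
      dot s x - dot s′ x                      ∎

    dot-⊹ : ∀ {n} (s x : Vector Carrier n) c y → dot s (x ⊹ c ∙ y) ≈ dot s x + c * dot s y
    dot-⊹ s x c y = begin
      dot s (x ⊹ c ∙ y)
        ≈⟨ sum-cong (λ t → solve 4 (λ s x c y → s :* (x :+ c :* y) := con 1ℤ :* (s :* x) :+ c :* (s :* y))
             refl (s t) (x t) c (y t)) ⟩
      sum (λ t → 1# * (s t * x t) + c * (s t * y t))
        ≈⟨ sum-linear 1# c (λ t → s t * x t) (λ t → s t * y t) ⟩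
      1# * dot s x + c * dot s y
        ≈⟨ +-congʳ (*-identityˡ _) ⟩
      dot s x + c * dot s y ∎

    unit : ∀ {n} → Fin n → Vector Carrier n
    unit zero    zero    = 1#
    unit zero    (suc j) = 0#
    unit (suc i) zero    = 0#
    unit (suc i) (suc j) = unit i j

    dot-unit : ∀ {n} (s : Vector Carrier n) i → dot s (unit i) ≈ s i
    dot-unit s zero    = trans (+-cong (*-identityʳ (s zero)) (sum-zero (λ t → zeroʳ (s (suc t))))) (+-identityʳ _)
    dot-unit s (suc i) = trans (+-cong (zeroʳ (s zero)) (dot-unit (s ∘ suc) i)) (+-identityˡ _)

    unit-comm : ∀ {n} (i j : Fin n) → unit i j ≈ unit j i
    unit-comm zero    zero    = refl
    unit-comm zero    (suc j) = refl
    unit-comm (suc i) zero    = refl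
    unit-comm (suc i) (suc j) = unit-comm i j

    open AffineFunction public using (slope; constant; eval)

    module _ {n} (f : AffineFunction ℛ n) where

      eval-cong : ∀ {x y} → x ≋ y → eval f x ≈ eval f y
      eval-cong x≋y = +-congʳ (dot-congʳ (slope f) x≋y)

      eval-⊹ : ∀ x c y → eval f (x ⊹ c ∙ y) ≈ eval f x + c * dot (slope f) y
      eval-⊹ x c y = trans (+-congʳ (dot-⊹ (slope f) x c y))
        (solve 4 (λ a c b k → a :+ c :* b :+ k := a :+ k :+ c :* b) refl (dot (slope f) x) c (dot (slope f) y) (constant f))

      eval-affineCombination : ∀ {k} (p : Fin k → Point ℛ n) (c : Vector Carrier k) → sum c ≈ 1# →
        eval f (λ t → ∑[ s < k ] (c s * p s t)) ≈ ∑[ s < k ] (c s * eval f (p s))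
      eval-affineCombination {k} p c ∑c≈1 = begin
        ∑[ t < n ] (slope f t * ∑[ s < k ] (c s * p s t)) + constant f
          ≈⟨ +-cong (sum-cong λ t → trans (*-distribˡ-sum (slope f t) (λ s → c s * p s t))
               (sum-cong λ s → solve 3 (λ a c p → a :* (c :* p) := c :* (a :* p)) refl (slope f t) (c s) (p s t)))
               (sym (trans (*-congʳ ∑c≈1) (*-identityˡ _))) ⟩
        ∑[ t < n ] ∑[ s < k ] (c s * (slope f t * p s t)) + sum c * constant f
          ≈⟨ +-cong (∑-comm (λ t s → c s * (slope f t * p s t))) (*-distribʳ-sum (constant f) c) ⟩
        ∑[ s < k ] ∑[ t < n ] (c s * (slope f t * p s t)) + ∑[ s < k ] (c s * constant f)
          ≈⟨ ∑-distrib-+ (λ s → ∑[ t < n ] (c s * (slope f t * p s t))) (λ s → c s * constant f) ⟨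
        ∑[ s < k ] (∑[ t < n ] (c s * (slope f t * p s t)) + c s * constant f)
          ≈⟨ sum-cong (λ s → trans (+-congʳ (sym (*-distribˡ-sum (c s) (λ t → slope f t * p s t))))
               (sym (distribˡ (c s) (dot (slope f) (p s)) (constant f)))) ⟩
        ∑[ s < k ] (c s * eval f (p s)) ∎

  open Affine

  -- Open convex sets, connectedness, and counting components.

  module Topology where

    ball-line : ∀ {n} (x : Point ℛ n) {ε} → 0# < ε → ∀ d → Small (λ δ → Ball ℛ x ε (x ⊹ δ ∙ d))
    ball-line x {ε} 0<ε d = small-∀ λ t → small-map
      (λ δ _ (lower , upper) →
          <-by lower (solve 4 (λ x ε δ d → ε :+ δ :* d := (x :+ δ :* d) :- (x :- ε)) refl (x t) ε δ (d t))
        , <-by upper (solve 4 (λ x ε δ d → ε :+ δ :* :- d := (x :+ ε) :- (x :+ δ :* d)) refl (x t) ε δ (d t)))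
      (small-× (small-+* 0<ε (d t)) (small-+* 0<ε (- d t)))

    ball-≋ : ∀ {n} {x y : Point ℛ n} {ε} → 0# < ε → x ≋ y → Ball ℛ x ε y
    ball-≋ {x = x} {y} {ε} 0<ε x≋y t =
        <-resp-≈ refl (x≋y t) (<-by 0<ε (solve 2 (λ x ε → ε := x :- (x :- ε)) refl (x t) ε))
      , <-resp-≈ (x≋y t) refl (<-by 0<ε (solve 2 (λ x ε → ε := (x :+ ε) :- x) refl (x t) ε))

    open-line : ∀ {n} {U : Pred (Point ℛ n) 0ℓ} → IsOpen ℛ U → ∀ {x} → x ∈ U → ∀ d → Small (λ δ → x ⊹ δ ∙ d ∈ U)
    open-line openU {x} x∈U d with openU x x∈U
    ... | ε , 0<ε , ball⊆U = small-map (λ _ _ → ball⊆U) (ball-line x 0<ε d)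

    -- A predicate on points need not respect pointwise equality. An open one does, because each
    -- ball about x contains every point pointwise equal to x.
    open-≋ : ∀ {n} {U : Pred (Point ℛ n) 0ℓ} → IsOpen ℛ U → ∀ {x y} → x ≋ y → x ∈ U → y ∈ U
    open-≋ openU {x} x≋y x∈U with openU x x∈U
    ... | ε , 0<ε , ball⊆U = ball⊆U (ball-≋ 0<ε x≋y)

    segment : ∀ {n} → Point ℛ n → Point ℛ n → Carrier → Point ℛ n
    segment x y c = x ⊹ c ∙ (y ⊖ x)

    -- Quantifying over all z pointwise equal to the convex combination makes
    -- convex sets closed under pointwise equality.
    Convex : ∀ {n} → Pred (Point ℛ n) 0ℓ → Set
    Convex P = ∀ {x y} → x ∈ P → y ∈ P → ∀ {c} → 0# ≤ c → c ≤ 1# → ∀ {z} → z ≋ segment x y c → z ∈ P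

    module _ {n} {C : Pred (Point ℛ n) 0ℓ} (convex : Convex C) where

      -- Let s be the supremum of the parameters at which the segment from u to v is in U. If γ s ∈
      -- U, then s = 1, as U would otherwise contain γ a little beyond s, and so v lies in both
      -- sets. If γ s ∈ V, then V also contains γ c for some c in T at or just below s.
      convex⇒connected : IsConnected ℛ C
      convex⇒connected U V openU openV C⊆U∪V (u , u∈C , u∈U) (v , v∈C , v∈V) = result
        where
        γ : Carrier → Point ℛ n
        γ = segment u v
        T : Pred Carrier 0ℓ
        T c = (0# ≤ c × c ≤ 1#) × γ c ∈ U
        γ∈C : ∀ {c} → 0# ≤ c → c ≤ 1# → γ c ∈ C
        γ∈C 0≤c c≤1 = convex u∈C v∈C 0≤c c≤1 (λ _ → refl)
        γ-cong : ∀ {c c′} → c ≈ c′ → γ c ≋ γ c′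
        γ-cong c≈c′ t = +-congˡ (*-congʳ c≈c′)
        0∈T : T 0#
        0∈T = (≤.refl , proj₁ 0<1) , open-≋ openU (λ t → solve 2 (λ u v → u := u :+ con 0ℤ :* (v :- u)) refl (u t) (v t)) u∈U
        γ1≋v : γ 1# ≋ v
        γ1≋v t = solve 2 (λ u v → u :+ con 1ℤ :* (v :- u) := v) refl (u t) (v t)
        sup = supremum T (0# , 0∈T) (1# , λ _ t∈T → proj₂ (proj₁ t∈T))
        s = proj₁ sup
        upper : ∀ c → c ∈ T → c ≤ s
        upper = proj₁ (proj₂ sup)
        least : ∀ b → (∀ c → c ∈ T → c ≤ b) → s ≤ b
        least = proj₂ (proj₂ sup)
        0≤s : 0# ≤ s
        0≤s = upper 0# 0∈T
        s≤1 : s ≤ 1#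
        s≤1 = least 1# (λ _ t∈T → proj₂ (proj₁ t∈T))
        γ-shift : ∀ δ c → γ s ⊹ δ ∙ (λ t → c * (v t - u t)) ≋ γ (s + δ * c)
        γ-shift δ c t = solve 5 (λ u v s δ c → u :+ s :* (v :- u) :+ δ :* (c :* (v :- u)) := u :+ (s :+ δ :* c) :* (v :- u))
          refl (u t) (v t) s δ c
        small-shift : ∀ {W} → IsOpen ℛ W → γ s ∈ W → ∀ c → Small (λ δ → γ (s + δ * c) ∈ W)
        small-shift openW γs∈W c = small-map (λ δ _ → open-≋ openW (γ-shift δ c))
          (open-line openW γs∈W (λ t → c * (v t - u t)))
        Result : Set
        Result = Satisfiable (C ∩ (U ∩ V))
        beyond : γ s ∈ U → s < 1# → ∃[ δ ] 0# < δ × γ (s + δ * 1#) ∈ U × δ ≤ 1# - s → Result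
        beyond γs∈U s<1 (δ , 0<δ , γ∈U , δ≤1-s) =
          contradiction (upper (s + δ * 1#) ((≤.trans 0≤s (proj₁ s<) , s+δ≤1) , γ∈U)) (λ ≤s → ≤⇒≯ ≤s s<)
          where
          s< : s < s + δ * 1#
          s< = <-by 0<δ (solve 2 (λ s δ → δ := s :+ δ :* con 1ℤ :- s) refl s δ)
          s+δ≤1 : s + δ * 1# ≤ 1#
          s+δ≤1 = ≤-by (≤⇒0≤- δ≤1-s) (solve 2 (λ s δ → con 1ℤ :- s :- δ := con 1ℤ :- (s :+ δ :* con 1ℤ)) refl s δ)
        caseU : γ s ∈ U → Dec (s ≈ 1#) → Result
        caseU γs∈U (yes s≈1) = v , v∈C , open-≋ openU (λ t → trans (γ-cong s≈1 t) (γ1≋v t)) γs∈U , v∈V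
        caseU γs∈U (no s≉1)  = beyond γs∈U (s≤1 , s≉1)
          (small-witness (small-× (small-shift openU γs∈U 1#) (small-≤ (<⇒0<- (s≤1 , s≉1)))))
        caseV : γ s ∈ V → Small (λ δ → γ (s + δ * - 1#) ∈ V) → Result
        caseV γs∈V (ε , 0<ε , near) = pick (em 0ℓ)
          where
          pick : Dec (∃[ c ] T c × s - ε < c) → Result
          pick (no ¬∃) = contradiction (least (s - ε) (λ c c∈T → ≮⇒≥ (λ s-ε<c → ¬∃ (c , c∈T , s-ε<c))))
            (λ s≤s-ε → ≤⇒≯ s≤s-ε (<-by 0<ε (solve 2 (λ s ε → ε := s :- (s :- ε)) refl s ε)))
          pick (yes (c , c∈T@((0≤c , c≤1) , γc∈U) , s-ε<c)) = γ c , γ∈C 0≤c c≤1 , γc∈U , γc∈V (c ≈? s)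
            where
            γc∈V : Dec (c ≈ s) → γ c ∈ V
            γc∈V (yes c≈s) = open-≋ openV (γ-cong (sym c≈s)) γs∈V
            γc∈V (no c≉s)  = open-≋ openV (γ-cong (solve 2 (λ s c → s :+ (s :- c) :* (:- con 1ℤ) := c) refl s c))
              (near (s - c) (<⇒0<- (upper c c∈T , c≉s))
                (≤-by (proj₁ (<⇒0<- s-ε<c)) (solve 3 (λ s ε c → c :- (s :- ε) := ε :- (s :- c)) refl s ε c)))
        result : Result
        result = Sum.[ (λ γs∈U → caseU γs∈U (s ≈? 1#)) , (λ γs∈V → caseV γs∈V (small-shift openV γs∈V (- 1#))) ]′
          (C⊆U∪V (γ∈C 0≤s s≤1))

    ⟦_⟧ : Set → ℤ
    ⟦ P ⟧ = 𝟙 (em 0ℓ {P})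

    ⟦⟧-nonneg : ∀ P → 0ℤ ℤ.≤ ⟦ P ⟧
    ⟦⟧-nonneg P with em 0ℓ {P}
    ... | yes _ = ℤ.+≤+ ℕ.z≤n
    ... | no _  = ℤ.+≤+ ℕ.z≤n

    module Multiplicity {a} {A : Set a} (x : A) where

      multiplicity : List (Pred A 0ℓ) → ℤ
      multiplicity Ps = ∑ₗ Ps (λ P → ⟦ P x ⟧)

      0≤multiplicity : ∀ Ps → 0ℤ ℤ.≤ multiplicity Ps
      0≤multiplicity []       = ℤ.≤-refl
      0≤multiplicity (P ∷ Ps) = ℤ.+-mono-≤ (⟦⟧-nonneg (P x)) (0≤multiplicity Ps)

      1≤multiplicity : ∀ Ps k → List.lookup Ps k x → 1ℤ ℤ.≤ multiplicity Ps
      1≤multiplicity (P ∷ Ps) zero    p =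
        ℤ.+-mono-≤ (ℤ.≤-reflexive (≡.sym (𝟙-yes (em 0ℓ) p))) (0≤multiplicity Ps)
      1≤multiplicity (P ∷ Ps) (suc k) p = ℤ.+-mono-≤ (⟦⟧-nonneg (P x)) (1≤multiplicity Ps k p)

      multiplicity≤1⇒unique : ∀ Ps → multiplicity Ps ℤ.≤ 1ℤ →
        ∀ j k → List.lookup Ps j x → List.lookup Ps k x → j ≡ k
      multiplicity≤1⇒unique (P ∷ Ps) ≤1 zero    zero    _ _ = ≡.refl
      multiplicity≤1⇒unique (P ∷ Ps) ≤1 zero    (suc k) p q = contradiction (ℤ.≤-trans 2≤ ≤1) λ where (ℤ.+≤+ (ℕ.s≤s ()))
        where 2≤ = ℤ.+-mono-≤ (ℤ.≤-reflexive (≡.sym (𝟙-yes (em 0ℓ) p))) (1≤multiplicity Ps k q)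
      multiplicity≤1⇒unique (P ∷ Ps) ≤1 (suc j) zero    p q = contradiction (ℤ.≤-trans 2≤ ≤1) λ where (ℤ.+≤+ (ℕ.s≤s ()))
        where 2≤ = ℤ.+-mono-≤ (ℤ.≤-reflexive (≡.sym (𝟙-yes (em 0ℓ) q))) (1≤multiplicity Ps j p)
      multiplicity≤1⇒unique (P ∷ Ps) ≤1 (suc j) (suc k) p q = ≡.cong suc (multiplicity≤1⇒unique Ps
        (ℤ.≤-trans (ℤ.≤-trans (ℤ.≤-reflexive (≡.sym (ℤ.+-identityˡ _))) (ℤ.+-monoˡ-≤ _ (⟦⟧-nonneg (P x)))) ≤1) j k p q)

      0<multiplicity⇒∃ : ∀ Ps → multiplicity Ps ≢ 0ℤ → ∃[ k ] List.lookup Ps k x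
      0<multiplicity⇒∃ []       ≢0 = contradiction ≡.refl ≢0
      0<multiplicity⇒∃ (P ∷ Ps) ≢0 with em 0ℓ {P x}
      ... | yes p = zero , p
      ... | no _  with 0<multiplicity⇒∃ Ps (λ ≡0 → ≢0 (≡.trans (ℤ.+-identityˡ _) ≡0))
      ...   | k , q = suc k , q

    open Multiplicity public

    multiplicity-satisfiable : ∀ {a} {A : Set a} (x : A) Ps →
      multiplicity x (List.filter (λ P → em a {Satisfiable P}) Ps) ≡ multiplicity x Ps
    multiplicity-satisfiable x []       = ≡.refl
    multiplicity-satisfiable {a} x (P ∷ Ps) with em a {Satisfiable P}
    ... | yes _   = ≡.cong (ℤ._+_ ⟦ P x ⟧) (multiplicity-satisfiable x Ps)
    ... | no ¬sat = ≡.trans (multiplicity-satisfiable x Ps)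
      (≡.sym (≡.trans (≡.cong (ℤ._+ multiplicity x Ps) (𝟙-no (em 0ℓ {P x}) (λ p → ¬sat (x , p)))) (ℤ.+-identityˡ _)))

    -- A single equation states that the sets are disjoint, lie in X and cover X. In this form the
    -- property passes to intersections by multiplication and feeds directly into linear relations
    -- of indicators.
    Partitions : ∀ {n} → List (Pred (Point ℛ n) 0ℓ) → Pred (Point ℛ n) 0ℓ → Set
    Partitions Ps X = ∀ x → multiplicity x Ps ≡ ⟦ X x ⟧

    OpenConvex : ∀ {n} → Pred (Point ℛ n) 0ℓ → Set
    OpenConvex P = IsOpen ℛ P × Convex P

    satisfiable : ∀ {n} → List (Pred (Point ℛ n) 0ℓ) → List (Pred (Point ℛ n) 0ℓ)
    satisfiable = List.filter (λ P → em 0ℓ {Satisfiable P})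

    module _ {n} {X : Pred (Point ℛ n) 0ℓ} where

      -- Each nonempty member is connected, being convex, and it is cut off from the others because
      -- both it and the union of the others are open.
      components-of-partition : ∀ Ps → All OpenConvex Ps → Partitions Ps X →
                                HasComponents ℛ X (List.length (satisfiable Ps))
      components-of-partition Ps openConvex partition = record
        { to        = to
        ; cong      = λ { {j} ≡.refl → Setoid.refl (Components ℛ X) {to j} }
        ; bijective = (λ {j} {k} → injective j k) , surjective }
        where
        Qs = satisfiable Ps
        Q : Fin (List.length Qs) → Pred (Point ℛ n) 0ℓ
        Q = List.lookup Qs
        Q-sat : ∀ k → Satisfiable (Q k)
        Q-sat k = All.lookup (All.all-filter (λ P → em 0ℓ {Satisfiable P}) Ps) (∈ₗ.∈-lookup k)
        Q-openConvex : ∀ k → OpenConvex (Q k)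
        Q-openConvex k = All.lookup (All.filter⁺ (λ P → em 0ℓ {Satisfiable P}) openConvex) (∈ₗ.∈-lookup k)
        partitionQ : Partitions Qs X
        partitionQ x = ≡.trans (multiplicity-satisfiable x Ps) (partition x)
        Q⊆X : ∀ k → Q k ⊆ X
        Q⊆X k {x} x∈Q with em 0ℓ {X x} | partitionQ x | 1≤multiplicity x Qs k x∈Q
        ... | yes x∈X | _  | _  = x∈X
        ... | no _    | eq | 1≤ = contradiction (≡.subst (1ℤ ℤ.≤_) eq 1≤) λ where (ℤ.+≤+ ())
        disjoint : ∀ {x} j k → x ∈ Q j → x ∈ Q k → j ≡ k
        disjoint {x} = multiplicity≤1⇒unique x Qs (≡.subst (ℤ._≤ 1ℤ) (≡.sym (partitionQ x)) (bound (X x)))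
          where
          bound : ∀ P → ⟦ P ⟧ ℤ.≤ 1ℤ
          bound P with em 0ℓ {P}
          ... | yes _ = ℤ.+≤+ (ℕ.s≤s ℕ.z≤n)
          ... | no _  = ℤ.+≤+ ℕ.z≤n
        cover : ∀ {x} → x ∈ X → ∃[ k ] x ∈ Q k
        cover {x} x∈X = 0<multiplicity⇒∃ x Qs (λ ≡0 → contradiction
          (≡.trans (≡.sym ≡0) (≡.trans (partitionQ x) (𝟙-yes (em 0ℓ) x∈X))) λ ())
        to : Fin (List.length Qs) → ∃ X
        to k = proj₁ (Q-sat k) , Q⊆X k (proj₂ (Q-sat k))
        injective : ∀ j k → SameComponent ℛ X (proj₁ (to j)) (proj₁ (to k)) → j ≡ k
        injective j k (C , C⊆X , connected , xⱼ∈C , xₖ∈C) with j Fin.≟ k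
        ... | yes j≡k = j≡k
        ... | no  j≢k with connected (Q j) V (proj₁ (Q-openConvex j)) openV covers
                             (_ , xⱼ∈C , proj₂ (Q-sat j)) (_ , xₖ∈C , k , j≢k , proj₂ (Q-sat k))
          where
          V : Pred (Point ℛ n) 0ℓ
          V x = ∃[ l ] j ≢ l × x ∈ Q l
          openV : IsOpen ℛ V
          openV x (l , j≢l , x∈Ql) with proj₁ (Q-openConvex l) x x∈Ql
          ... | ε , 0<ε , ball⊆ = ε , 0<ε , λ y∈ball → l , j≢l , ball⊆ y∈ball
          covers : C ⊆ Q j ∪ V
          covers x∈C with cover (C⊆X x∈C)
          ... | l , x∈Ql with j Fin.≟ l
          ...   | yes ≡.refl = inj₁ x∈Ql
          ...   | no  j≢l    = inj₂ (l , j≢l , x∈Ql)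
        ...   | _ , _ , x∈Qj , l , j≢l , x∈Ql = contradiction (disjoint j l x∈Qj x∈Ql) j≢l
        surjective : ∀ y → ∃[ k ] (∀ {j} → j ≡ k → SameComponent ℛ X (proj₁ (to j)) (proj₁ y))
        surjective (y , y∈X) with cover y∈X
        ... | k , y∈Qk = k , λ { ≡.refl →
          Q k , Q⊆X k , convex⇒connected (proj₂ (Q-openConvex k)) , proj₂ (Q-sat k) , y∈Qk }

  open Topology

  -- Linear relations between indicators of open convex sets.

  module EulerRelation where

    Weighted : Set₁ → Set₁
    Weighted A = List (ℤ × A)

    ∑ʷ : ∀ {A} → Weighted A → (A → Set) → ℤ
    ∑ʷ L P = ∑ₗ L (λ (c , a) → c ℤ.* ⟦ P a ⟧)

    ∑ʷ-cong : ∀ {A} L {P Q : A → Set} → (∀ a → P a → Q a) → (∀ a → Q a → P a) → ∑ʷ L P ≡ ∑ʷ L Q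
    ∑ʷ-cong L f g = ∑ₗ-cong L (λ (c , a) → ≡.cong (c ℤ.*_) (𝟙-cong (em 0ℓ) (em 0ℓ) (f a) (g a)))

    ∑ʷ-additive : ∀ {A} {L : Weighted A} {P Q R : A → Set} →
      All (λ (_ , a) → ⟦ P a ⟧ ≡ ⟦ Q a ⟧ ℤ.+ ⟦ R a ⟧) L → ∑ʷ L P ≡ ∑ʷ L Q ℤ.+ ∑ʷ L R
    ∑ʷ-additive {L = L} {P} {Q} {R} eqs = ≡.trans
      (∑ₗ-cong-All (All.map (λ {(c , a)} eq → ≡.trans (≡.cong (c ℤ.*_) eq) (ℤ.*-distribˡ-+ c ⟦ Q a ⟧ ⟦ R a ⟧)) eqs))
      (∑ₗ-distrib-+ (λ (c , a) → c ℤ.* ⟦ Q a ⟧) (λ (c , a) → c ℤ.* ⟦ R a ⟧) L)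

    ∑ʷ-empty : ∀ {A} (L : Weighted A) {P : A → Set} → (∀ a → ¬ P a) → ∑ʷ L P ≡ 0ℤ
    ∑ʷ-empty L ¬P = ≡.trans
      (∑ₗ-cong L (λ (c , a) → ≡.trans (≡.cong (c ℤ.*_) (𝟙-no (em 0ℓ) (¬P a))) (ℤ.*-zeroʳ c))) (∑ₗ-zero L)

    discard : ∀ {A} (Q : A → Set) → Weighted A → Weighted A
    discard Q = List.filter (λ (_ , a) → ¬? (em 0ℓ {Q a}))

    ∑ʷ-discard : ∀ {A} (Q P : A → Set) L → ∑ʷ (discard Q L) P ≡ ∑ʷ L (λ a → P a × ¬ Q a)
    ∑ʷ-discard Q P []            = ≡.refl
    ∑ʷ-discard Q P ((c , a) ∷ L) with em 0ℓ {Q a}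
    ... | yes q = ≡.trans (∑ʷ-discard Q P L) (≡.sym (≡.trans
      (≡.cong (ℤ._+ ∑ʷ L (λ a → P a × ¬ Q a)) (≡.trans (≡.cong (c ℤ.*_) (𝟙-no (em 0ℓ) (λ (_ , ¬q) → ¬q q))) (ℤ.*-zeroʳ c)))
      (ℤ.+-identityˡ _)))
    ... | no ¬q = ≡.cong₂ ℤ._+_ (≡.cong (c ℤ.*_) (𝟙-cong (em 0ℓ) (em 0ℓ) (_, ¬q) proj₁)) (∑ʷ-discard Q P L)

    module _ {A : Set₁} {K : Set} (S : A → Set) (E : K → A → Set)
             (E⇒S : ∀ {k a} → E k a → S a)
             (exchange : ∀ {k k′ a b} → E k a → E k′ a → E k b → E k′ b) where

      -- The class of the head's key has sum 0 and is removed, then the rest is treated alike. Keys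
      -- will be reals up to ≈, so one item can have many; `exchange` makes keys with a common item
      -- interchangeable. The bound N drives the recursion because `discard` does not return a
      -- structural sublist.
      sum-over-keys : ∀ N (L : Weighted A) → List.length L ℕ.≤ N →
        All (λ (_ , a) → S a → ∃[ k ] E k a) L → (∀ k → ∑ʷ L (E k) ≡ 0ℤ) → ∑ʷ L S ≡ 0ℤ
      sum-over-keys N       []               _          _            _     = ≡.refl
      sum-over-keys (suc N) L@((c , a) ∷ L′) (ℕ.s≤s len) (key ∷ keys) zeros = go (em 0ℓ)
        where
        head-free : ∀ {P : A → Set} → ¬ P a → ∑ʷ L P ≡ ∑ʷ L′ P
        head-free {P} ¬Pa = ≡.trans
          (≡.cong (ℤ._+ ∑ʷ L′ P) (≡.trans (≡.cong (c ℤ.*_) (𝟙-no (em 0ℓ) ¬Pa)) (ℤ.*-zeroʳ c))) (ℤ.+-identityˡ _)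
        go : Dec (S a) → ∑ʷ L S ≡ 0ℤ
        go (no ¬s) = ≡.trans (head-free ¬s)
          (sum-over-keys N L′ len keys (λ k → ≡.trans (≡.sym (head-free (¬s ∘ E⇒S))) (zeros k)))
        go (yes s) = ≡.trans (∑ʷ-additive {R = λ b → S b × ¬ E k b} (All.universal split L))
          (≡.cong₂ ℤ._+_ (zeros k) (≡.trans (head-free (λ (_ , ¬e) → ¬e Eka))
            (≡.trans (≡.sym (∑ʷ-discard (E k) S L′))
              (sum-over-keys N (discard (E k) L′) (ℕ.≤-trans (List.length-filter _ L′) len) (All.filter⁺ _ keys) zeros′))))
          where
          k = proj₁ (key s)
          Eka = proj₂ (key s)
          split : ∀ ((_ , b) : ℤ × A) → ⟦ S b ⟧ ≡ ⟦ E k b ⟧ ℤ.+ ⟦ S b × ¬ E k b ⟧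
          split (_ , b) = case em 0ℓ {E k b} of λ where
            (yes e) → ≡.trans (𝟙-yes (em 0ℓ) (E⇒S e)) (≡.sym (≡.cong₂ ℤ._+_ (𝟙-yes (em 0ℓ) e) (𝟙-no (em 0ℓ) (λ (_ , ¬e) → ¬e e))))
            (no ¬e) → ≡.trans (𝟙-cong (em 0ℓ) (em 0ℓ) (_, ¬e) proj₁)
              (≡.sym (≡.trans (≡.cong (ℤ._+ ⟦ S b × ¬ E k b ⟧) (𝟙-no (em 0ℓ) ¬e)) (ℤ.+-identityˡ _)))
          -- If some item has both keys, the classes coincide and nothing with key k′ is left.
          -- Otherwise they are disjoint and the class of k′ has lost nothing.
          zeros′ : ∀ k′ → ∑ʷ (discard (E k) L′) (E k′) ≡ 0ℤ
          zeros′ k′ = ≡.trans (∑ʷ-discard (E k) (E k′) L′) (common (em _ {∃[ b ] E k b × E k′ b}))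
            where
            common : Dec (∃[ b ] E k b × E k′ b) → ∑ʷ L′ (λ b → E k′ b × ¬ E k b) ≡ 0ℤ
            common (yes (_ , e , e′)) = ∑ʷ-empty L′ (λ _ (e″ , ¬e) → ¬e (exchange e′ e e″))
            common (no ¬∃) = ≡.trans (∑ʷ-cong L′ (λ _ → proj₁) (λ b e′ → e′ , λ e → ¬∃ (b , e , e′)))
              (≡.trans (≡.sym (head-free (λ e′ → ¬∃ (a , Eka , e′)))) (zeros k′))

    record Interval (I : Pred Carrier 0ℓ) : Set where
      field
        right-open : ∀ {t} → t ∈ I → Small (λ δ → t + δ ∈ I)
        left-open  : ∀ {t} → t ∈ I → Small (λ δ → t - δ ∈ I)
        between    : ∀ {x y z} → x ∈ I → y ∈ I → x ≤ z → z ≤ y → z ∈ I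

    Cofinal : Carrier → Pred Carrier 0ℓ → Set
    Cofinal t I = ∃[ x ] x ∈ I × t < x

    -- The right end of an interval; nothing stands for +∞.
    Ends : Maybe Carrier → Pred Carrier 0ℓ → Set
    Ends (just b) I = (∀ x → x ∈ I → x < b) × (∀ t → t < b → Cofinal t I)
    Ends nothing  I = ∀ t → Cofinal t I

    x-1<x : ∀ x → x - 1# < x
    x-1<x x = <-by 0<1 (solve 1 (λ x → con 1ℤ := x :- (x :- con 1ℤ)) refl x)

    x<x+1 : ∀ x → x < x + 1#
    x<x+1 x = <-by 0<1 (solve 1 (λ x → con 1ℤ := x :+ con 1ℤ :- x) refl x)

    Ends⇒Satisfiable : ∀ {e I} → Ends e I → Satisfiable I
    Ends⇒Satisfiable {just b} (_ , cofinal) = let x , x∈I , _ = cofinal (b - 1#) (x-1<x b) in x , x∈I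
    Ends⇒Satisfiable {nothing} cofinal      = let x , x∈I , _ = cofinal 0# in x , x∈I

    Ends-≤ : ∀ {b b′ I} → Ends (just b) I → Ends (just b′) I → b ≤ b′
    Ends-≤ (_ , cofinal) (bound , _) = ≮⇒≥ λ b′<b →
      let x , x∈I , b′<x = cofinal _ b′<b in ≤⇒≯ (proj₁ (bound x x∈I)) b′<x

    Ends-exchange : ∀ {e e′ I J} → Ends e I → Ends e′ I → Ends e J → Ends e′ J
    Ends-exchange {just b}  {just b′} p q (bound , cofinal) =
        (λ x x∈J → <-≤-trans (bound x x∈J) (Ends-≤ p q))
      , (λ t t<b′ → cofinal t (<-≤-trans t<b′ (Ends-≤ q p)))
    Ends-exchange {just b}  {nothing} (bound , _) q _ =
      let x , x∈I , b<x = q b in contradiction (bound x x∈I) (≤⇒≯ (proj₁ b<x))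
    Ends-exchange {nothing} {just b}  p (bound , _) _ =
      let x , x∈I , b<x = p b in contradiction (bound x x∈I) (≤⇒≯ (proj₁ b<x))
    Ends-exchange {nothing} {nothing} _ _ r = r

    ¬Cofinal⇒UpperBound : ∀ I t → ¬ Cofinal t I → ∀ x → x ∈ I → x ≤ t
    ¬Cofinal⇒UpperBound I t ¬cofinal x x∈I = ≮⇒≥ (λ t<x → ¬cofinal (x , x∈I , t<x))

    module _ {I : Pred Carrier 0ℓ} (interval : Interval I) where
      open Interval interval

      end : Satisfiable I → ∃[ e ] Ends e I
      end sat = go (em 0ℓ {Satisfiable (UpperBound I)})
        where
        go : Dec (Satisfiable (UpperBound I)) → ∃[ e ] Ends e I
        go (no unbounded) = nothing , λ t → decidable-stable (em 0ℓ)
          (λ ¬cofinal → unbounded (t , ¬Cofinal⇒UpperBound I t ¬cofinal))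
        go (yes bounded) with supremum I sat bounded
        ... | b , upper , least = just b , below , λ t t<b → decidable-stable (em 0ℓ)
                (λ ¬cofinal → ≤⇒≯ (least t (¬Cofinal⇒UpperBound I t ¬cofinal)) t<b)
          where
          -- The supremum is not attained, since an interval that is open on the right reaches
          -- beyond each of its points.
          below : ∀ x → x ∈ I → x < b
          below x x∈I with small-witness (right-open x∈I)
          ... | δ , 0<δ , x+δ∈I =
            <-≤-trans (<-by 0<δ (solve 2 (λ x δ → δ := x :+ δ :- x) refl x δ)) (upper (x + δ) x+δ∈I)

      -- The indicator of I drops by 1 on arrival at b from the left if I ends at b, and otherwise
      -- does not drop. A relation that holds at b and just before b therefore holds for the
      -- intervals ending at b.
      jump : ∀ b → Small (λ δ → ⟦ I (b - δ) ⟧ ≡ ⟦ I b ⟧ ℤ.+ ⟦ Ends (just b) I ⟧)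
      jump b = go (em 0ℓ) (em 0ℓ)
        where
        b-δ<b : ∀ {δ} → 0# < δ → b - δ < b
        b-δ<b {δ} 0<δ = <-by 0<δ (solve 2 (λ b δ → δ := b :- (b :- δ)) refl b δ)
        -- If I has a point at or beyond b, then b - δ ∈ I would force b ∈ I. Otherwise b is a
        -- strict bound, and as it is not the end, some t < b has no point of I above it.
        absent : ¬ I b → ¬ Ends (just b) I → Small (λ δ → ¬ I (b - δ))
        absent b∉I ¬ends = beyond (em 0ℓ {∃[ x ] x ∈ I × b ≤ x})
          where
          gap : (∀ x → x ∈ I → x < b) → Dec (∃[ t ] t < b × ¬ Cofinal t I) → Small (λ δ → ¬ I (b - δ))
          gap bound (yes (t , t<b , ¬cofinal)) = small-map
            (λ δ _ 0< b-δ∈I → ¬cofinal (b - δ , b-δ∈I ,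
              <-by 0< (solve 3 (λ t b δ → b :- t :+ δ :* :- con 1ℤ := b :- δ :- t) refl t b δ)))
            (small-+* (<⇒0<- t<b) (- 1#))
          gap bound (no ¬gap) = contradiction
            (bound , λ t t<b → decidable-stable (em 0ℓ) (λ ¬cofinal → ¬gap (t , t<b , ¬cofinal))) ¬ends
          beyond : Dec (∃[ x ] x ∈ I × b ≤ x) → Small (λ δ → ¬ I (b - δ))
          beyond (yes (x , x∈I , b≤x)) = small-pure (λ δ 0<δ b-δ∈I → b∉I (between b-δ∈I x∈I (proj₁ (b-δ<b 0<δ)) b≤x))
          beyond (no ¬beyond) = gap (λ x x∈I → ≰⇒> (λ b≤x → ¬beyond (x , x∈I , b≤x))) (em 0ℓ)
        go : Dec (I b) → Dec (Ends (just b) I) → Small (λ δ → ⟦ I (b - δ) ⟧ ≡ ⟦ I b ⟧ ℤ.+ ⟦ Ends (just b) I ⟧)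
        go (yes b∈I) _ = small-map
          (λ δ _ b-δ∈I → ≡.trans (𝟙-yes (em 0ℓ) b-δ∈I) (≡.sym (≡.cong₂ ℤ._+_ (𝟙-yes (em 0ℓ) b∈I)
            (𝟙-no (em 0ℓ) (λ (bound , _) → <-irrefl refl (bound b b∈I))))))
          (left-open b∈I)
        go (no b∉I) (yes ends@(bound , cofinal)) with cofinal (b - 1#) (x-1<x b)
        ... | x , x∈I , _ = small-map
          (λ δ 0<δ δ≤ → let y , y∈I , b-δ<y = cofinal (b - δ) (b-δ<b 0<δ) in
            ≡.trans (𝟙-yes (em 0ℓ) (between x∈I y∈I
                (≤-by (≤⇒0≤- δ≤) (solve 3 (λ b x δ → b :- x :- δ := b :- δ :- x) refl b x δ)) (proj₁ b-δ<y)))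
              (≡.sym (≡.cong₂ ℤ._+_ (𝟙-no (em 0ℓ) b∉I) (𝟙-yes (em 0ℓ) ends))))
          (small-≤ (<⇒0<- (bound x x∈I)))
        go (no b∉I) (no ¬ends) = small-map
          (λ δ _ b-δ∉I → ≡.trans (𝟙-no (em 0ℓ) b-δ∉I) (≡.sym (≡.cong₂ ℤ._+_ (𝟙-no (em 0ℓ) b∉I) (𝟙-no (em 0ℓ) ¬ends))))
          (absent b∉I ¬ends)

      -- This is the counterpart of `jump` at +∞, where the relation is evaluated at one point
      -- beyond all finite ends.
      eventually : ∃[ T ] (∀ t → T ≤ t → ⟦ I t ⟧ ≡ ⟦ Ends nothing I ⟧)
      eventually with em 0ℓ {∃[ t ] ¬ Cofinal t I}
      ... | yes (t , ¬cofinal) = t + 1# , λ u t+1≤u → 𝟙-cong (em 0ℓ) (em 0ℓ)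
              (λ u∈I → contradiction (u , u∈I , <-≤-trans (x<x+1 t) t+1≤u) ¬cofinal)
              (λ cofinal → contradiction (cofinal t) ¬cofinal)
      ... | no ¬∃ = proj₁ (cofinal 0#) , λ u x≤u → 𝟙-cong (em 0ℓ) (em 0ℓ)
              (λ _ → cofinal)
              (λ _ → let y , y∈I , u<y = cofinal u in between (proj₁ (proj₂ (cofinal 0#))) y∈I x≤u (proj₁ u<y))
        where
        cofinal : ∀ t → Cofinal t I
        cofinal t = decidable-stable (em 0ℓ) (λ ¬cofinal → ¬∃ (t , ¬cofinal))

    eventually-All : ∀ {L : Weighted (Pred Carrier 0ℓ)} → All (Interval ∘ proj₂) L →
      ∃[ T ] (∀ t → T ≤ t → All (λ (_ , I) → ⟦ I t ⟧ ≡ ⟦ Ends nothing I ⟧) L)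
    eventually-All []       = 0# , λ _ _ → []
    eventually-All (i ∷ is) with eventually i | eventually-All is
    ... | T , p | T′ , ps with ≤.total T T′
    ...   | inj₁ T≤T′ = T′ , λ t T′≤t → p t (≤.trans T≤T′ T′≤t) ∷ ps t T′≤t
    ...   | inj₂ T′≤T = T , λ t T≤t → p t T≤t ∷ ps t (≤.trans T′≤T T≤t)

    interval-relation : ∀ (L : Weighted (Pred Carrier 0ℓ)) → All (Interval ∘ proj₂) L →
      (∀ t → ∑ʷ L (λ I → I t) ≡ 0ℤ) → ∑ʷ L Satisfiable ≡ 0ℤ
    interval-relation L intervals vanishes =
      sum-over-keys Satisfiable Ends Ends⇒Satisfiable Ends-exchange (List.length L) L ℕ.≤-refl
        (All.map end intervals) zeros
      where
      zeros : ∀ e → ∑ʷ L (Ends e) ≡ 0ℤ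
      zeros nothing with eventually-All intervals
      ... | T , eventual = ≡.trans
        (≡.sym (∑ₗ-cong-All (All.map (λ {(c , _)} → ≡.cong (c ℤ.*_)) (eventual T ≤.refl)))) (vanishes T)
      zeros (just b) with small-witness (small-All (All.map (λ i → jump i b) intervals))
      ... | δ , _ , jumps = ≡.trans (≡.sym (ℤ.+-identityˡ _)) (≡.trans
        (≡.cong (ℤ._+ ∑ʷ L (Ends (just b))) (≡.sym (vanishes b)))
        (≡.trans (≡.sym (∑ʷ-additive jumps)) (vanishes (b - δ))))

    infixr 5 _◂_
    _◂_ : ∀ {n} → Carrier → Point ℛ n → Point ℛ (suc n)
    t ◂ y = t Vector.∷ y

    slice : ∀ {n} → Carrier → Pred (Point ℛ (suc n)) 0ℓ → Pred (Point ℛ n) 0ℓ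
    slice t P y = P (t ◂ y)

    shadow : ∀ {n} → Pred (Point ℛ (suc n)) 0ℓ → Pred Carrier 0ℓ
    shadow P t = Satisfiable (slice t P)

    module _ {n} {P : Pred (Point ℛ (suc n)) 0ℓ} (openConvexP : OpenConvex P) where

      private
        openP   = proj₁ openConvexP
        convexP = proj₂ openConvexP

      slice-openConvex : ∀ t → OpenConvex (slice t P)
      slice-openConvex t = openS , convexS
        where
        openS : IsOpen ℛ (slice t P)
        openS y y∈ with openP (t ◂ y) y∈
        ... | ε , 0<ε , ball⊆P = ε , 0<ε , λ y′∈ball → ball⊆P λ where
          zero    → ball-≋ {x = t ◂ y} 0<ε (λ _ → refl) zero
          (suc i) → y′∈ball i
        convexS : Convex (slice t P)
        convexS x∈ y∈ {c} 0≤c c≤1 z≋ = convexP x∈ y∈ 0≤c c≤1 λ where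
          zero    → solve 2 (λ t c → t := t :+ c :* (t :- t)) refl t c
          (suc i) → z≋ i

      shadow-interval : Interval (shadow P)
      shadow-interval = record
        { right-open = λ {t} → shift 1# (λ δ → solve 2 (λ t δ → t :+ δ :* con 1ℤ := t :+ δ) refl t δ)
        ; left-open  = λ {t} → shift (- 1#) (λ δ → solve 2 (λ t δ → t :+ δ :* :- con 1ℤ := t :- δ) refl t δ)
        ; between    = between }
        where
        shift : ∀ {t} d {f : Carrier → Carrier} → (∀ δ → t + δ * d ≈ f δ) → t ∈ shadow P → Small (λ δ → f δ ∈ shadow P)
        shift {t} d t+δd≈ (y , ty∈P) = small-map
          (λ δ _ ∈P → y , open-≋ openP (λ where
            zero    → t+δd≈ δ
            (suc i) → solve 2 (λ y δ → y :+ δ :* con 0ℤ := y) refl (y i) δ) ∈P)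
          (open-line openP ty∈P (d ◂ λ _ → 0#))
        between : ∀ {x y z} → x ∈ shadow P → y ∈ shadow P → x ≤ z → z ≤ y → z ∈ shadow P
        between {x} {y} {z} (u , xu∈P) (v , yv∈P) x≤z z≤y = go (x ≈? y)
          where
          go : Dec (x ≈ y) → z ∈ shadow P
          -- Equal end points rule out the quotient (z - x)/(y - x) used below, but then z equals x.
          go (yes x≈y) = u , open-≋ openP (λ where
            zero    → ≤.antisym x≤z (≤-resp-≈ refl (sym x≈y) z≤y)
            (suc i) → refl) xu∈P
          go (no x≉y) with inverse-pos (<⇒0<- (≤.trans x≤z z≤y , x≉y))
          ... | w , 0<w , [y-x]w≈1 = (λ i → u i + c * (v i - u i)) , convexP xu∈P yv∈P
              (*-nonneg (≤⇒0≤- x≤z) (proj₁ 0<w))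
              (≤-by (*-nonneg (≤⇒0≤- z≤y) (proj₁ 0<w)) (trans
                (solve 4 (λ x y z w → (y :- z) :* w := (y :- x) :* w :- (z :- x) :* w) refl x y z w) (+-congʳ [y-x]w≈1)))
              λ where
                zero    → sym (trans
                  (solve 4 (λ x y z w → x :+ (z :- x) :* w :* (y :- x) := x :+ (z :- x) :* ((y :- x) :* w)) refl x y z w)
                            (trans (+-congˡ (*-congˡ [y-x]w≈1)) (solve 2 (λ x z → x :+ (z :- x) :* con 1ℤ := z) refl x z)))
                (suc i) → refl
            where c = (z - x) * w

    -- Induction on the dimension: the relation holds on every slice, so the shadows
    -- on the first axis satisfy the hypothesis of the one-dimensional case.
    euler-relation : ∀ {n} (L : Weighted (Pred (Point ℛ n) 0ℓ)) → All (OpenConvex ∘ proj₂) L →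
      (∀ x → ∑ʷ L (λ P → P x) ≡ 0ℤ) → ∑ʷ L Satisfiable ≡ 0ℤ
    euler-relation {zero} L openConvex vanishes = ≡.trans
      -- Up to pointwise equality ℝ⁰ has one point, so a nonempty open set contains it.
      (∑ₗ-cong-All (All.map (λ {(c , P)} (openP , _) → ≡.cong (c ℤ.*_)
        (𝟙-cong (em 0ℓ) (em 0ℓ) (λ (x , x∈P) → open-≋ openP (λ ()) x∈P) (λ o∈P → _ , o∈P))) openConvex))
      (vanishes (λ ()))
    euler-relation {suc n} L openConvex vanishes = ≡.trans
      (∑ₗ-cong-All (All.map (λ {(c , P)} (openP , _) → ≡.cong (c ℤ.*_) (𝟙-cong (em 0ℓ) (em 0ℓ)
        (λ (x , x∈P) → x zero , x ∘ suc , open-≋ openP (λ { zero → refl ; (suc _) → refl }) x∈P)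
        (λ (t , y , ty∈P) → t ◂ y , ty∈P))) openConvex))
      (≡.trans (≡.sym (∑ₗ-map (λ (c , P) → c , shadow P) _ L))
        (interval-relation (List.map (λ (c , P) → c , shadow P) L) (All.map⁺ (All.map shadow-interval openConvex)) λ t →
          ≡.trans (∑ₗ-map (λ (c , P) → c , shadow P) _ L)
            (≡.trans (≡.sym (∑ₗ-map (λ (c , P) → c , slice t P) _ L))
              (euler-relation (List.map (λ (c , P) → c , slice t P) L)
                (All.map⁺ (All.map (λ oc → slice-openConvex oc t) openConvex))
                (λ y → ≡.trans (∑ₗ-map (λ (c , P) → c , slice t P) _ L) (vanishes (t ◂ y)))))))

  open EulerRelation

  -- Linear systems, generic vectors and bases of hyperplanes.

  module LinearAlgebra where

    open import Relation.Binary.Reasoning.Setoid setoid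

    NonZero : ∀ {n} → Vector Carrier n → Set
    NonZero v = ¬ (∀ t → v t ≈ 0#)

    nonZero-entry : ∀ {n} {v : Vector Carrier n} → NonZero v → ∃[ t ] ¬ v t ≈ 0#
    nonZero-entry {n} {v} = Fin.¬∀⟶∃¬ n (λ t → v t ≈ 0#) (λ t → v t ≈? 0#)

    punchIn-elim : ∀ {n p} (P : Pred (Fin (suc n)) p) i → P i → (∀ j → P (punchIn i j)) → ∀ k → P k
    punchIn-elim P i Pi Pj k with i Fin.≟ k
    ... | yes ≡.refl = Pi
    ... | no i≢k     = ≡.subst P (Fin.punchIn-punchOut i≢k) (Pj (Fin.punchOut i≢k))

    -- Gaussian elimination: a row with nonzero first entry removes the first unknown from the other
    -- rows and is finally solved for it. If the first column is zero, the first unit vector is a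
    -- solution.
    homogeneous-solution : ∀ k (rows : Fin k → Vector Carrier (suc k)) →
      ∃[ w ] NonZero w × (∀ i → dot (rows i) w ≈ 0#)
    homogeneous-solution zero    rows = (λ _ → 1#) , (λ 1≈0 → 0≉1 (sym (1≈0 zero))) , λ ()
    homogeneous-solution (suc k) rows with em 0ℓ {∃[ r ] ¬ rows r zero ≈ 0#}
    ... | no ¬pivot = unit zero , (λ 1≈0 → 0≉1 (sym (1≈0 zero))) , λ i →
      trans (dot-unit (rows i) zero) (decidable-stable (rows i zero ≈? 0#) (λ ≉0 → ¬pivot (i , ≉0)))
    ... | yes (r , a≉0) with homogeneous-solution k (λ j t →
            1# * rows (punchIn r j) (suc t) + - (rows (punchIn r j) zero * inv (rows r zero)) * rows r (suc t))
    ...   | w , w≉0 , solution = (- (b * dr)) Vector.∷ w , (λ ≈0 → w≉0 (≈0 ∘ suc)) ,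
            punchIn-elim _ r
              (begin
                a * - (b * dr) + dr        ≈⟨ solve 3 (λ a b d → a :* :- (b :* d) :+ d := d :- a :* b :* d) refl a b dr ⟩
                dr - a * b * dr            ≈⟨ +-congˡ (-‿cong (trans (*-congʳ (*-inv a≉0)) (*-identityˡ dr))) ⟩
                dr - dr                    ≈⟨ -‿inverseʳ dr ⟩
                0#                         ∎)
              (λ j → let x = rows (punchIn r j) zero ; dj = dot (rows (punchIn r j) ∘ suc) w in begin
                x * - (b * dr) + dj        ≈⟨ solve 4 (λ x b d e → x :* :- (b :* d) :+ e := con 1ℤ :* e :+ :- (x :* b) :* d)
                                                refl x b dr dj ⟩
                1# * dj + - (x * b) * dr   ≈⟨ dot-linearˡ 1# (- (x * b)) (rows (punchIn r j) ∘ suc) (rows r ∘ suc) w ⟨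
                _                          ≈⟨ solution j ⟩
                0#                         ∎)
      where
      a = rows r zero
      b = inv a
      dr = dot (rows r ∘ suc) w

    -- The n points impose n homogeneous conditions on n + 1 unknowns: the constant, at index 0, and
    -- the slope.
    vanishing-affineFunction : ∀ {n} (p : Fin n → Point ℛ n) →
      Σ[ f ∈ AffineFunction ℛ n ] (NonZero (slope f) ⊎ ¬ constant f ≈ 0#) × (∀ i → eval f (p i) ≈ 0#)
    vanishing-affineFunction {n} p with homogeneous-solution n (λ i → 1# Vector.∷ p i)
    ... | w , w≉0 , solution = f , nonConstant , λ i → begin
        dot (w ∘ suc) (p i) + w zero       ≈⟨ +-cong (dot-comm (w ∘ suc) (p i)) (sym (*-identityˡ (w zero))) ⟩
        dot (p i) (w ∘ suc) + 1# * w zero  ≈⟨ +-comm _ _ ⟩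
        dot (1# Vector.∷ p i) w            ≈⟨ solution i ⟩
        0#                                 ∎
      where
      f : AffineFunction ℛ n
      f = record { slope = w ∘ suc ; constant = w zero }
      nonConstant : NonZero (slope f) ⊎ ¬ constant f ≈ 0#
      nonConstant with w zero ≈? 0#
      ... | no w₀≉0  = inj₂ w₀≉0
      ... | yes w₀≈0 = inj₁ λ ≈0 → w≉0 λ where
        zero    → w₀≈0
        (suc t) → ≈0 t

    vanishes-on-span : ∀ {n k} (f : AffineFunction ℛ n) (p : Fin k → Point ℛ n) →
      (∀ i → eval f (p i) ≈ 0#) → ∀ {x} → x ∈ AffineSpan ℛ p → eval f x ≈ 0#
    vanishes-on-span f p zeros {x} (c , ∑c≈1 , x≈) = begin
      eval f x                                         ≈⟨ eval-cong f x≈ ⟩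
      eval f (λ t → sum (λ s → c s * p s t))           ≈⟨ eval-affineCombination f p c ∑c≈1 ⟩
      sum (λ s → c s * eval f (p s))                   ≈⟨ sum-zero (λ s → trans (*-congˡ (zeros s)) (zeroʳ (c s))) ⟩
      0#                                               ∎

    -- The affine hull of X is spanned by n points, so a nontrivial affine function vanishes on X.
    -- Short steps from x within X along the coordinate directions force its slope to be 0, and then
    -- its constant.
    codimension-1-has-no-interior : ∀ {n} {X : Pred (Point ℛ n) 0ℓ} → HasCodimension ℛ X 1 →
      ∀ {x} → x ∈ X → ¬ (∀ d → Small (λ δ → x ⊹ δ ∙ d ∈ X))
    codimension-1-has-no-interior {X = X} (d , dim , d+1≡n) {x} x∈X interior
      rewrite ≡.trans (≡.sym d+1≡n) (ℕ.+-comm d 1) = refute (vanishing-affineFunction basis)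
      where
      open HasDimension dim
      refute : ¬ (Σ[ f ∈ AffineFunction ℛ (suc d) ] (NonZero (slope f) ⊎ ¬ constant f ≈ 0#) × (∀ i → eval f (basis i) ≈ 0#))
      refute (f , nonZero , zeros) = Sum.[ (λ ≉0 → ≉0 slope≈0) , (λ ≉0 → ≉0 constant≈0) ]′ nonZero
        where
        f≈0 : ∀ {y} → y ∈ X → eval f y ≈ 0#
        f≈0 y∈X = vanishes-on-span f basis zeros (spanning y∈X)
        slope≈0 : ∀ t → slope f t ≈ 0#
        slope≈0 t with small-witness (interior (unit t))
        ... | δ , 0<δ , y∈X = *-cancel-0 (<⇒≉ 0<δ) (begin
          δ * slope f t                            ≈⟨ *-congˡ (dot-unit (slope f) t) ⟨
          δ * dot (slope f) (unit t)               ≈⟨ +-identityˡ _ ⟨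
          0# + δ * dot (slope f) (unit t)          ≈⟨ +-congʳ (f≈0 x∈X) ⟨
          eval f x + δ * dot (slope f) (unit t)    ≈⟨ eval-⊹ f x δ (unit t) ⟨
          eval f (x ⊹ δ ∙ unit t)                  ≈⟨ f≈0 y∈X ⟩
          0#                                       ∎)
        constant≈0 : constant f ≈ 0#
        constant≈0 = begin
          constant f                        ≈⟨ +-identityˡ _ ⟨
          0# + constant f                   ≈⟨ +-congʳ (sum-zero (λ t → trans (*-congʳ (slope≈0 t)) (zeroˡ (x t)))) ⟨
          eval f x                          ≈⟨ f≈0 x∈X ⟩
          0#                                ∎

    -- Finitely many hyperplanes through 0 do not fill the space. A q that lies on the hyperplane of
    -- v is moved along a coordinate where v is nonzero, by so little that the conditions already
    -- achieved persist.
    generic : ∀ {n} (L : List (Vector Carrier n)) → ∃[ q ] All (λ v → NonZero v → ¬ dot v q ≈ 0#) L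
    generic []      = (λ _ → 0#) , []
    generic (v ∷ L) with generic L
    ... | q , good with em 0ℓ {NonZero v × dot v q ≈ 0#}
    ...   | no ¬bad = q , (λ v≉0 vq≈0 → ¬bad (v≉0 , vq≈0)) ∷ good
    ...   | yes (v≉0 , vq≈0) = perturb (nonZero-entry v≉0)
      where
      perturb : (∃[ t ] ¬ v t ≈ 0#) → ∃[ q ] All (λ v → NonZero v → ¬ dot v q ≈ 0#) (v ∷ L)
      perturb (t , vt≉0) = conclude (small-witness (small-All (All.map survives good)))
        where
        dot-shift : ∀ u δ → dot u (q ⊹ δ ∙ unit t) ≈ dot u q + δ * u t
        dot-shift u δ = trans (dot-⊹ u q δ (unit t)) (+-congˡ (*-congˡ (dot-unit u t)))
        survives : ∀ {u} → (NonZero u → ¬ dot u q ≈ 0#) → Small (λ δ → NonZero u → ¬ dot u (q ⊹ δ ∙ unit t) ≈ 0#)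
        survives {u} g with em 0ℓ {NonZero u}
        ... | no ¬u≉0 = small-pure (λ _ _ u≉0 → contradiction u≉0 ¬u≉0)
        ... | yes u≉0 = small-map (λ δ _ ≉0 _ ≈0 → ≉0 (trans (sym (dot-shift u δ)) ≈0)) (small-≉ (g u≉0) (u t))
        conclude : (∃[ δ ] 0# < δ × All (λ u → NonZero u → ¬ dot u (q ⊹ δ ∙ unit t) ≈ 0#) L) →
                   ∃[ q ] All (λ v → NonZero v → ¬ dot v q ≈ 0#) (v ∷ L)
        conclude (δ , 0<δ , all) = q ⊹ δ ∙ unit t ,
          (λ _ ≈0 → *-nonzero (<⇒≉ 0<δ) vt≉0 (begin
            δ * v t                      ≈⟨ +-identityˡ _ ⟨
            0# + δ * v t                 ≈⟨ +-congʳ vq≈0 ⟨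
            dot v q + δ * v t            ≈⟨ dot-shift v δ ⟨
            dot v (q ⊹ δ ∙ unit t)       ≈⟨ ≈0 ⟩
            0#                           ∎)) ∷ all

    generic₂ : ∀ {n K} (V : Fin K → Fin K → Vector Carrier n) →
               ∃[ q ] (∀ a b → NonZero (V a b) → ¬ dot (V a b) q ≈ 0#)
    generic₂ {K = K} V with generic (List.cartesianProductWith V (List.allFin K) (List.allFin K))
    ... | q , good = q , λ a b → All.lookup good (∈ₗ.∈-cartesianProductWith⁺ V (∈ₗ.∈-allFin a) (∈ₗ.∈-allFin b))

    module Hyperplane {d} (D : Vector Carrier (suc d)) (t₀ : Fin (suc d)) (pivot : ¬ D t₀ ≈ 0#) where

      -- Directions 1, …, d span the kernel of D; direction 0 is the origin.
      direction : Fin (suc d) → Vector Carrier (suc d)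
      direction zero    = λ _ → 0#
      direction (suc j) = Vector.insertAt (unit j) t₀ (- (D (punchIn t₀ j) * inv (D t₀)))

      direction-pivot : ∀ j → direction (suc j) t₀ ≈ - (D (punchIn t₀ j) * inv (D t₀))
      direction-pivot j = reflexive (Vector.insertAt-lookup (unit j) t₀ _)

      direction-punchIn : ∀ j k → direction (suc j) (punchIn t₀ k) ≈ unit j k
      direction-punchIn j k = reflexive (Vector.insertAt-punchIn (unit j) t₀ _ k)

      dot-direction : ∀ s → dot D (direction s) ≈ 0#
      dot-direction zero    = sum-zero (λ t → zeroʳ (D t))
      dot-direction (suc j) = begin
        dot D (direction (suc j))
          ≈⟨ sum-remove {i = t₀} (λ t → D t * direction (suc j) t) ⟩
        D t₀ * direction (suc j) t₀ + sum (λ k → D (punchIn t₀ k) * direction (suc j) (punchIn t₀ k))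
          ≈⟨ +-cong (*-congˡ (direction-pivot j))
               (trans (dot-congʳ (D ∘ punchIn t₀) (direction-punchIn j)) (dot-unit (D ∘ punchIn t₀) j)) ⟩
        D t₀ * - (Dⱼ * inv (D t₀)) + Dⱼ
          ≈⟨ solve 3 (λ a b i → a :* :- (b :* i) :+ b := b :- a :* i :* b) refl (D t₀) Dⱼ (inv (D t₀)) ⟩
        Dⱼ - D t₀ * inv (D t₀) * Dⱼ
          ≈⟨ +-congˡ (-‿cong (trans (*-congʳ (*-inv pivot)) (*-identityˡ Dⱼ))) ⟩
        Dⱼ - Dⱼ
          ≈⟨ -‿inverseʳ Dⱼ ⟩
        0# ∎
        where Dⱼ = D (punchIn t₀ j)

      -- Off the pivot coordinate direction `suc j` is the unit vector j, so these coordinates read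
      -- off the coefficients. Both independence and spanning rest on this.
      combination-punchIn : ∀ (c : Vector Carrier (suc d)) k →
        ∑[ s < suc d ] (c s * direction s (punchIn t₀ k)) ≈ c (suc k)
      combination-punchIn c k = begin
        c zero * 0# + sum (λ j → c (suc j) * direction (suc j) (punchIn t₀ k))
          ≈⟨ +-cong (zeroʳ (c zero)) (dot-congʳ (c ∘ suc) (λ j → trans (direction-punchIn j k) (unit-comm j k))) ⟩
        0# + dot (c ∘ suc) (unit k)
          ≈⟨ trans (+-identityˡ _) (dot-unit (c ∘ suc) k) ⟩
        c (suc k) ∎

      module _ (p : Point ℛ (suc d)) (ρ : Carrier) where

        basis : Fin (suc d) → Point ℛ (suc d)
        basis s = p ⊹ ρ ∙ direction s

        combination : ∀ (c : Vector Carrier (suc d)) t →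
          ∑[ s < suc d ] (c s * basis s t) ≈ p t * sum c + ρ * ∑[ s < suc d ] (c s * direction s t)
        combination c t = trans
          (sum-cong λ s → solve 4 (λ c p r v → c :* (p :+ r :* v) := p :* c :+ r :* (c :* v)) refl (c s) (p t) ρ (direction s t))
          (sum-linear (p t) ρ c (λ s → c s * direction s t))

        module _ (ρ≉0 : ¬ ρ ≈ 0#) where

          basis-independent : AffinelyIndependent ℛ basis
          basis-independent c ∑c≈0 relation = λ where
              zero    → begin
                c zero                   ≈⟨ +-identityʳ _ ⟨
                c zero + 0#              ≈⟨ +-congˡ (sum-zero tail≈0) ⟨
                sum c                    ≈⟨ ∑c≈0 ⟩
                0#                       ∎
              (suc k) → tail≈0 k
            where
            tail≈0 : ∀ k → c (suc k) ≈ 0#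
            tail≈0 k = let t = punchIn t₀ k ; v = ∑[ s < suc d ] (c s * direction s t) in
              trans (sym (combination-punchIn c k)) (*-cancel-0 ρ≉0 (begin
                ρ * v                    ≈⟨ +-identityˡ _ ⟨
                0# + ρ * v               ≈⟨ +-congʳ (trans (*-congˡ ∑c≈0) (zeroʳ (p t))) ⟨
                p t * sum c + ρ * v      ≈⟨ combination c t ⟨
                ∑[ s < suc d ] (c s * basis s t) ≈⟨ relation t ⟩
                0#                       ∎))

          -- The coordinates off the pivot determine the coefficients k, and the coefficient at
          -- index 0 brings the sum to 1. The pivot coordinate then fits because D takes equal
          -- values at x and p.
          basis-spanning : ∀ {x} → dot D x ≈ dot D p → x ∈ AffineSpan ℛ basis
          basis-spanning {x} Dx≈Dp = c , ∑c≈1 , punchIn-elim _ t₀ at-pivot at-punchIn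
            where
            k : Vector Carrier d
            k j = (x (punchIn t₀ j) - p (punchIn t₀ j)) * inv ρ
            c : Vector Carrier (suc d)
            c = (1# - sum k) Vector.∷ k
            ∑c≈1 : sum c ≈ 1#
            ∑c≈1 = solve 1 (λ s → con 1ℤ :- s :+ s := con 1ℤ) refl (sum k)
            reduce : ∀ t {v} → ∑[ s < suc d ] (c s * direction s t) ≈ v → ρ * v ≈ x t - p t →
                     x t ≈ ∑[ s < suc d ] (c s * basis s t)
            reduce t {v} eq ρv≈ = sym (begin
              ∑[ s < suc d ] (c s * basis s t)   ≈⟨ combination c t ⟩
              p t * sum c + ρ * _                ≈⟨ +-cong (trans (*-congˡ ∑c≈1) (*-identityʳ (p t))) (trans (*-congˡ eq) ρv≈) ⟩
              p t + (x t - p t)                  ≈⟨ solve 2 (λ x p → p :+ (x :- p) := x) refl (x t) (p t) ⟩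
              x t                                ∎)
            ρk : ∀ j → ρ * k j ≈ x (punchIn t₀ j) - p (punchIn t₀ j)
            ρk j = trans (solve 3 (λ r y i → r :* (y :* i) := r :* i :* y) refl ρ (x (punchIn t₀ j) - p (punchIn t₀ j)) (inv ρ))
              (trans (*-congʳ (*-inv ρ≉0)) (*-identityˡ _))
            at-punchIn : ∀ j → x (punchIn t₀ j) ≈ ∑[ s < suc d ] (c s * basis s (punchIn t₀ j))
            at-punchIn j = reduce (punchIn t₀ j) (combination-punchIn c j) (ρk j)
            i₀ = inv (D t₀)
            D·k = dot (D ∘ punchIn t₀) k
            rest = dot (D ∘ punchIn t₀) (λ j → x (punchIn t₀ j) - p (punchIn t₀ j))
            at-pivot : x t₀ ≈ ∑[ s < suc d ] (c s * basis s t₀)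
            at-pivot = reduce t₀ {v = - i₀ * D·k}
              (begin
                c zero * 0# + sum (λ j → k j * direction (suc j) t₀)
                  ≈⟨ +-cong (zeroʳ (c zero)) (sum-cong λ j → trans (*-congˡ (direction-pivot j))
                       (solve 3 (λ k D i → k :* :- (D :* i) := :- i :* (D :* k)) refl (k j) (D (punchIn t₀ j)) i₀)) ⟩
                0# + sum (λ j → - i₀ * (D (punchIn t₀ j) * k j))
                  ≈⟨ trans (+-identityˡ _) (sym (*-distribˡ-sum (- i₀) (λ j → D (punchIn t₀ j) * k j))) ⟩
                - i₀ * D·k ∎)
              (begin
                ρ * (- i₀ * D·k)
                  ≈⟨ solve 3 (λ r i s → r :* (:- i :* s) := :- i :* (r :* s)) refl ρ i₀ D·k ⟩
                - i₀ * (ρ * D·k)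
                  ≈⟨ *-congˡ (trans (*-distribˡ-sum ρ (λ j → D (punchIn t₀ j) * k j))
                       (sum-cong λ j → trans (solve 3 (λ r D k → r :* (D :* k) := D :* (r :* k)) refl ρ (D (punchIn t₀ j)) (k j))
                         (*-congˡ (ρk j)))) ⟩
                - i₀ * rest
                  -- The pivot term is added and subtracted, so that the second bracket becomes D ·
                  -- (x - p), which is 0.
                  ≈⟨ solve 4 (λ i s D y → :- i :* s := D :* i :* y :- i :* (D :* y :+ s)) refl i₀ rest (D t₀) (x t₀ - p t₀) ⟩
                D t₀ * i₀ * (x t₀ - p t₀) - i₀ * (D t₀ * (x t₀ - p t₀) + rest)
                  ≈⟨ +-cong (trans (*-congʳ (*-inv pivot)) (*-identityˡ _)) (-‿cong (trans (*-congˡ total≈0) (zeroʳ i₀))) ⟩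
                x t₀ - p t₀ - 0#
                  ≈⟨ solve 1 (λ y → y :- con 0ℤ := y) refl (x t₀ - p t₀) ⟩
                x t₀ - p t₀ ∎)
              where
              total≈0 : D t₀ * (x t₀ - p t₀) + rest ≈ 0#
              total≈0 = begin
                D t₀ * (x t₀ - p t₀) + rest    ≈⟨ sum-remove {i = t₀} (λ t → D t * (x t - p t)) ⟨
                dot D (x ⊖ p)                  ≈⟨ dot-comm D (x ⊖ p) ⟩
                dot (x ⊖ p) D                  ≈⟨ dot-⊖ x p D ⟩
                dot x D - dot p D              ≈⟨ +-cong (dot-comm x D) (-‿cong (dot-comm p D)) ⟩
                dot D x - dot D p              ≈⟨ x≈y⇒x-y≈0 Dx≈Dp ⟩
                0#                             ∎

  open LinearAlgebra

  -- A codimension-1 tie wherever different pieces share the maximum.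

  module Envelope where

    open import Relation.Binary.Reasoning.Setoid setoid

    module _ {n K} (f : Fin K → AffineFunction ℛ n) where

      Same : Rel (Fin K) 0ℓ
      Same a c = ∀ x → eval (f a) x ≈ eval (f c) x

      -- The set of MaxoutUnits.H, for a single unit.
      Tie : Fin K → Fin K → Pred (Point ℛ n) 0ℓ
      Tie a b x = eval (f a) x ≈ eval (f b) x × (∀ c → eval (f c) x ≤ eval (f a) x)

      Δ : Fin K → Fin K → Vector Carrier n
      Δ a c = slope (f a) ⊖ slope (f c)

      gap : Fin K → Fin K → Point ℛ n → Carrier
      gap a c x = eval (f a) x - eval (f c) x

      gap-⊹ : ∀ a c x δ y → gap a c (x ⊹ δ ∙ y) ≈ gap a c x + δ * dot (Δ a c) y
      gap-⊹ a c x δ y = begin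
        eval (f a) (x ⊹ δ ∙ y) - eval (f c) (x ⊹ δ ∙ y)
          ≈⟨ +-cong (eval-⊹ (f a) x δ y) (-‿cong (eval-⊹ (f c) x δ y)) ⟩
        eval (f a) x + δ * dot (slope (f a)) y - (eval (f c) x + δ * dot (slope (f c)) y)
          ≈⟨ solve 5 (λ A C δ s t → A :+ δ :* s :- (C :+ δ :* t) := (A :- C) :+ δ :* (s :- t)) refl
               (eval (f a) x) (eval (f c) x) δ (dot (slope (f a)) y) (dot (slope (f c)) y) ⟩
        gap a c x + δ * (dot (slope (f a)) y - dot (slope (f c)) y)
          ≈⟨ +-congˡ (*-congˡ (dot-⊖ (slope (f a)) (slope (f c)) y)) ⟨
        gap a c x + δ * dot (Δ a c) y ∎

      gap-cong : ∀ a c {x y} → x ≋ y → gap a c x ≈ gap a c y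
      gap-cong a c x≋y = +-cong (eval-cong (f a) x≋y) (-‿cong (eval-cong (f c) x≋y))

      gaps⇒Tie : ∀ {a b} x → gap a b x ≈ 0# → (∀ c → 0# ≤ gap a c x) → Tie a b x
      gaps⇒Tie x gap≈0 0≤gap = x-y≈0⇒x≈y gap≈0 , λ c → 0≤-⇒≤ (0≤gap c)

      parallel⇒Same : ∀ {a c} x → eval (f a) x ≈ eval (f c) x → (∀ t → Δ a c t ≈ 0#) → Same a c
      parallel⇒Same {a} {c} x eq Δ≈0 y = x-y≈0⇒x≈y (begin
        gap a c y                              ≈⟨ gap-cong a c (λ t →
          solve 2 (λ x y → x :+ con 1ℤ :* (y :- x) := y) refl (x t) (y t)) ⟨
        gap a c (x ⊹ 1# ∙ (y ⊖ x))             ≈⟨ gap-⊹ a c x 1# (y ⊖ x) ⟩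
        gap a c x + 1# * dot (Δ a c) (y ⊖ x)   ≈⟨ +-cong (x≈y⇒x-y≈0 eq)
          (*-congˡ (sum-zero λ t → trans (*-congʳ (Δ≈0 t)) (zeroˡ _))) ⟩
        0# + 1# * 0#                           ≈⟨ solve 0 (con 0ℤ :+ con 1ℤ :* con 0ℤ := con 0ℤ) refl ⟩
        0#                                     ∎)

    module _ {d K} (f : Fin K → AffineFunction ℛ (suc d)) where

      HasTieOfCodimension-1 : Point ℛ (suc d) → Set
      HasTieOfCodimension-1 x = ∃₂ λ a b → a ≢ b × HasCodimension ℛ (Tie f a b) 1 × x ∈ Tie f a b

      -- Near x only the pieces attaining the maximum matter, and up to a common
      -- affine function they are linear forms.  For the generic line p + τ q their upper
      -- envelope has a breakpoint y at which the active forms agree on the whole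
      -- hyperplane where two of them, a and b, agree; the tie of a and b then contains
      -- a relative neighbourhood of x + δ y in that hyperplane.
      module Breakpoint (x : Point ℛ (suc d)) {a₀ c₀ : Fin K}
        (a₀-max : ∀ c → eval (f c) x ≤ eval (f a₀) x)
        (c₀-max : eval (f c₀) x ≈ eval (f a₀) x) (distinct : ¬ Same f a₀ c₀) where

        Active : Pred (Fin K) 0ℓ
        Active c = eval (f c) x ≈ eval (f a₀) x

        module _ (q : Vector Carrier (suc d)) (q-generic : ∀ a c → NonZero (Δ f a c) → ¬ dot (Δ f a c) q ≈ 0#)
                 {a : Fin K} (a-active : Active a)
                 (a-steepest : ∀ c → Active c → dot (slope (f c)) q ≤ dot (slope (f a)) q) where

          Rival : Pred (Fin K) 0ℓ
          Rival c = Active c × NonZero (Δ f a c)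

          -- All active pieces agree at x. Were a₀ and c₀ both parallel to a, they would coincide
          -- with it and with each other.
          rival : ∃ Rival
          rival with em 0ℓ {NonZero (Δ f a a₀)} | em 0ℓ {NonZero (Δ f a c₀)}
          ... | yes ≉0 | _      = a₀ , refl , ≉0
          ... | no _   | yes ≉0 = c₀ , c₀-max , ≉0
          ... | no ¬≉0 | no ¬≉0′ = contradiction
            (λ y → trans (sym (same refl ¬≉0 y)) (same c₀-max ¬≉0′ y)) distinct
            where
            same : ∀ {c} → Active c → ¬ NonZero (Δ f a c) → Same f a c
            same {c} active ¬≉0 = parallel⇒Same f x (trans a-active (sym active)) (decidable-stable (em 0ℓ) ¬≉0)

          speed : Fin K → Carrier
          speed c = dot (Δ f a c) q

          speed-pos : ∀ {c} → Rival c → 0# < speed c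
          speed-pos {c} (active , ≉0) =
              ≤-resp-≈ refl (sym (dot-⊖ (slope (f a)) (slope (f c)) q)) (≤⇒0≤- (a-steepest c active))
            , λ 0≈ → q-generic a c ≉0 (sym 0≈)

          -- This combination of the two differences annihilates q. For rivals b and c it is zero
          -- only if the differences are proportional; otherwise a generic p separates the times at
          -- which b and c are met.
          minor : Fin K → Fin K → Vector Carrier (suc d)
          minor b c t = speed b * Δ f a c t + - speed c * Δ f a b t

          module _ (p : Vector Carrier (suc d)) (p-generic : ∀ b c → NonZero (minor b c) → ¬ dot (minor b c) p ≈ 0#) where

            -- For a rival c the forms of a and c agree at this parameter τ of the line p + τ q, and
            -- a is ahead afterwards, its speed being positive.
            time : Fin K → Carrier
            time c = - dot (Δ f a c) p * inv (speed c)

            speed*time : ∀ {c} → Rival c → speed c * time c ≈ - dot (Δ f a c) p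
            speed*time {c} r = trans
              (solve 3 (λ s d i → s :* (:- d :* i) := s :* i :* :- d) refl (speed c) (dot (Δ f a c) p) (inv (speed c)))
              (trans (*-congʳ (*-inv (<⇒≉ (speed-pos r)))) (*-identityˡ _))

            module _ {b : Fin K} (b-rival : Rival b) (b-last : ∀ c → Rival c → time c ≤ time b) where

              -- This is the last crossing on the line: here a is level with b and is not below any
              -- other active form.
              y : Vector Carrier (suc d)
              y = p ⊹ time b ∙ q

              Δ·y : ∀ {c} → Rival c → dot (Δ f a c) y ≈ speed c * (time b - time c)
              Δ·y {c} r = begin
                dot (Δ f a c) y                             ≈⟨ dot-⊹ (Δ f a c) p (time b) q ⟩
                dot (Δ f a c) p + time b * speed c          ≈⟨ solve 3 (λ D T s → D :+ T :* s := s :* T :- :- D)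
                                                                  refl (dot (Δ f a c) p) (time b) (speed c) ⟩
                speed c * time b - - dot (Δ f a c) p        ≈⟨ +-congˡ (-‿cong (speed*time r)) ⟨
                speed c * time b - speed c * time c         ≈⟨ solve 3 (λ s T T′ → s :* T :- s :* T′ := s :* (T :- T′))
                                                                  refl (speed c) (time b) (time c) ⟩
                speed c * (time b - time c)                 ∎

              rival? : ∀ {c} → Active c → (∀ t → Δ f a c t ≈ 0#) ⊎ Rival c
              rival? {c} active = case em 0ℓ {∀ t → Δ f a c t ≈ 0#} of λ where
                (yes ≈0) → inj₁ ≈0
                (no ≉0)  → inj₂ (active , ≉0)

              parallel-dot : ∀ {c} → (∀ t → Δ f a c t ≈ 0#) → ∀ v → dot (Δ f a c) v ≈ 0#
              parallel-dot Δ≈0 v = sum-zero (λ t → trans (*-congʳ (Δ≈0 t)) (zeroˡ (v t)))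

              0≤Δ·y : ∀ {c} → Active c → 0# ≤ dot (Δ f a c) y
              0≤Δ·y active = Sum.[ (λ Δ≈0 → ≤.reflexive (sym (parallel-dot Δ≈0 y)))
                , (λ r → ≤-resp-≈ refl (sym (Δ·y r)) (*-nonneg (proj₁ (speed-pos r)) (≤⇒0≤- (b-last _ r)))) ]′ (rival? active)

              Δb·y≈0 : dot (Δ f a b) y ≈ 0#
              Δb·y≈0 = trans (Δ·y b-rival) (solve 2 (λ s T → s :* (T :- T) := con 0ℤ) refl (speed b) (time b))

              -- A rival c that is level with a at y crosses at the same time as b. Then `minor b c`
              -- kills p, so it is 0 by genericity, and Δ f a c is a multiple of Δ f a b.
              Δ·y≈0⇒parallel : ∀ {c} → Active c → dot (Δ f a c) y ≈ 0# →
                               ∀ v → dot (Δ f a b) v ≈ 0# → dot (Δ f a c) v ≈ 0#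
              Δ·y≈0⇒parallel {c} active Δy≈0 v Δbv≈0 = Sum.[ (λ Δ≈0 → parallel-dot Δ≈0 v) , tied ]′ (rival? active)
                where
                minor-p : Rival c → dot (minor b c) p ≈ 0#
                minor-p r = begin
                  dot (minor b c) p
                    ≈⟨ dot-linearˡ (speed b) (- speed c) (Δ f a c) (Δ f a b) p ⟩
                  speed b * dot (Δ f a c) p + - speed c * dot (Δ f a b) p
                    ≈⟨ solve 4 (λ s D s′ D′ → s :* D :+ :- s′ :* D′ := s′ :* :- D′ :- s :* :- D) refl
                         (speed b) (dot (Δ f a c) p) (speed c) (dot (Δ f a b) p) ⟩
                  speed c * - dot (Δ f a b) p - speed b * - dot (Δ f a c) p
                    ≈⟨ +-cong (*-congˡ (speed*time b-rival)) (-‿cong (*-congˡ (speed*time r))) ⟨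
                  speed c * (speed b * time b) - speed b * (speed c * time c)
                    ≈⟨ solve 4 (λ s s′ T T′ → s′ :* (s :* T) :- s :* (s′ :* T′) := s :* (s′ :* (T :- T′))) refl
                         (speed b) (speed c) (time b) (time c) ⟩
                  speed b * (speed c * (time b - time c))
                    ≈⟨ *-congˡ (trans (sym (Δ·y r)) Δy≈0) ⟩
                  speed b * 0#
                    ≈⟨ zeroʳ (speed b) ⟩
                  0# ∎
                minor-v : (∀ t → minor b c t ≈ 0#) → dot (Δ f a c) v ≈ 0#
                minor-v minor≈0 = *-cancel-0 (<⇒≉ (speed-pos b-rival)) (begin
                  speed b * dot (Δ f a c) v
                    ≈⟨ solve 2 (λ u s → u := u :+ :- s :* con 0ℤ) refl (speed b * dot (Δ f a c) v) (speed c) ⟩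
                  speed b * dot (Δ f a c) v + - speed c * 0#
                    ≈⟨ +-congˡ (*-congˡ Δbv≈0) ⟨
                  speed b * dot (Δ f a c) v + - speed c * dot (Δ f a b) v
                    ≈⟨ dot-linearˡ (speed b) (- speed c) (Δ f a c) (Δ f a b) v ⟨
                  dot (minor b c) v
                    ≈⟨ sum-zero (λ t → trans (*-congʳ (minor≈0 t)) (zeroˡ (v t))) ⟩
                  0# ∎)
                tied : Rival c → dot (Δ f a c) v ≈ 0#
                tied r = case em 0ℓ {NonZero (minor b c)} of λ where
                  (yes ≉0)  → contradiction (minor-p r) (p-generic b c ≉0)
                  (no ¬≉0) → minor-v (decidable-stable (em 0ℓ) ¬≉0)

              module _ {t₀ : Fin (suc d)} (pivot : ¬ Δ f a b t₀ ≈ 0#) where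
                open Hyperplane (Δ f a b) t₀ pivot

                -- The first of two nested choices: ε keeps a on top of the active forms at every
                -- vertex around y. Forms level with a at y remain level, as the directions lie in
                -- the kernel of Δ f a b, and the others start strictly below.
                inner : ∀ s c → Small (λ ε → Active c → 0# ≤ dot (Δ f a c) (y ⊹ ε ∙ direction s))
                inner s c = go (em 0ℓ) (dot (Δ f a c) y ≈? 0#)
                  where
                  go : Dec (Active c) → Dec (dot (Δ f a c) y ≈ 0#) →
                       Small (λ ε → Active c → 0# ≤ dot (Δ f a c) (y ⊹ ε ∙ direction s))
                  go (no inactive) _ = small-pure (λ _ _ active → contradiction active inactive)
                  go (yes active) (yes ≈0) = small-pure λ ε _ _ → ≤.reflexive (sym (begin
                    dot (Δ f a c) (y ⊹ ε ∙ direction s)                  ≈⟨ dot-⊹ (Δ f a c) y ε (direction s) ⟩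
                    dot (Δ f a c) y + ε * dot (Δ f a c) (direction s)    ≈⟨ +-cong ≈0
                      (*-congˡ (Δ·y≈0⇒parallel active ≈0 (direction s) (dot-direction s))) ⟩
                    0# + ε * 0#                                          ≈⟨ solve 1 (λ ε → con 0ℤ :+ ε :* con 0ℤ := con 0ℤ) refl ε ⟩
                    0#                                                   ∎))
                  go (yes active) (no ≉0) = small-map
                    (λ ε _ 0< _ → proj₁ (<-resp-≈ refl (sym (dot-⊹ (Δ f a c) y ε (direction s))) 0<))
                    (small-+* (0≤Δ·y active , ≉0 ∘ sym) (dot (Δ f a c) (direction s)))

                -- The scale δ is chosen after ε. The gap to an active piece is 0 at x, so it
                -- becomes δ times a nonnegative number for any δ; the gap to an inactive piece is
                -- positive at x and stays so for small δ.
                outer : ∀ {ε} → (∀ s c → Active c → 0# ≤ dot (Δ f a c) (y ⊹ ε ∙ direction s)) →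
                        ∀ s c → Small (λ δ → 0# ≤ gap f a c (x ⊹ δ ∙ (y ⊹ ε ∙ direction s)))
                outer {ε} ok s c = go (em 0ℓ)
                  where
                  z = y ⊹ ε ∙ direction s
                  go : Dec (Active c) → Small (λ δ → 0# ≤ gap f a c (x ⊹ δ ∙ z))
                  go (yes active) = small-pure λ δ 0<δ → ≤-resp-≈ refl
                    (begin
                      δ * dot (Δ f a c) z                   ≈⟨ +-identityˡ _ ⟨
                      0# + δ * dot (Δ f a c) z              ≈⟨ +-congʳ (x≈y⇒x-y≈0 (trans a-active (sym active))) ⟨
                      gap f a c x + δ * dot (Δ f a c) z     ≈⟨ gap-⊹ f a c x δ z ⟨
                      gap f a c (x ⊹ δ ∙ z)                 ∎)
                    (*-nonneg (proj₁ 0<δ) (ok s c active))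
                  go (no inactive) = small-map
                    (λ δ _ 0< → proj₁ (<-resp-≈ refl (sym (gap-⊹ f a c x δ z)) 0<))
                    (small-+* (<⇒0<- (<-≤-trans (a₀-max c , inactive) (≤.reflexive (sym a-active)))) (dot (Δ f a c) z))

                tie : HasTieOfCodimension-1 x
                tie with small-witness (small-∀ λ s → small-∀ λ c → inner s c)
                ... | ε , 0<ε , ok with small-witness (small-∀ λ s → small-∀ λ c → outer ok s c)
                ...   | δ , 0<δ , ok′ = a , b , a≢b , (d , dimension , ℕ.+-comm d 1)
                        , trans a-active (sym (proj₁ b-rival)) , λ c → ≤.trans (a₀-max c) (≤.reflexive (sym a-active))
                  where
                  a≢b : a ≢ b
                  a≢b ≡.refl = proj₂ b-rival (λ t → -‿inverseʳ (slope (f a) t))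
                  origin : Point ℛ (suc d)
                  origin = x ⊹ δ ∙ y
                  ρ = δ * ε
                  basis≋ : ∀ s → x ⊹ δ ∙ (y ⊹ ε ∙ direction s) ≋ basis origin ρ s
                  basis≋ s t = solve 5 (λ x δ y ε v → x :+ δ :* (y :+ ε :* v) := x :+ δ :* y :+ δ :* ε :* v) refl
                    (x t) δ (y t) ε (direction s t)
                  gap-b≈0 : ∀ v → dot (Δ f a b) v ≈ 0# → gap f a b (x ⊹ δ ∙ (y ⊹ ε ∙ v)) ≈ 0#
                  gap-b≈0 v v≈0 = begin
                    gap f a b (x ⊹ δ ∙ (y ⊹ ε ∙ v))                         ≈⟨ gap-⊹ f a b x δ (y ⊹ ε ∙ v) ⟩
                    gap f a b x + δ * dot (Δ f a b) (y ⊹ ε ∙ v)             ≈⟨ +-cong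
                      (x≈y⇒x-y≈0 (trans a-active (sym (proj₁ b-rival))))
                      (*-congˡ (trans (dot-⊹ (Δ f a b) y ε v) (+-cong Δb·y≈0 (*-congˡ v≈0)))) ⟩
                    0# + δ * (0# + ε * 0#)                                  ≈⟨ solve 2 (λ δ ε →
                      con 0ℤ :+ δ :* (con 0ℤ :+ ε :* con 0ℤ) := con 0ℤ) refl δ ε ⟩
                    0#                                                      ∎
                  basis∈Tie : ∀ s → basis origin ρ s ∈ Tie f a b
                  basis∈Tie s = gaps⇒Tie f (basis origin ρ s)
                    (trans (gap-cong f a b (λ t → sym (basis≋ s t))) (gap-b≈0 (direction s) (dot-direction s)))
                    (λ c → ≤-resp-≈ refl (gap-cong f a c (basis≋ s)) (ok′ s c))
                  gap-Δ : ∀ z → dot (Δ f a b) z ≈ gap f a b z - gap f a b (λ _ → 0#)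
                  gap-Δ z = begin
                    dot (Δ f a b) z
                      ≈⟨ solve 2 (λ g u → u := g :+ con 1ℤ :* u :- g) refl (gap f a b (λ _ → 0#)) (dot (Δ f a b) z) ⟩
                    gap f a b (λ _ → 0#) + 1# * dot (Δ f a b) z - gap f a b (λ _ → 0#)
                      ≈⟨ +-congʳ (gap-⊹ f a b (λ _ → 0#) 1# z) ⟨
                    gap f a b ((λ _ → 0#) ⊹ 1# ∙ z) - gap f a b (λ _ → 0#)
                      ≈⟨ +-congʳ (gap-cong f a b (λ t → solve 1 (λ z → con 0ℤ :+ con 1ℤ :* z := z) refl (z t))) ⟩
                    gap f a b z - gap f a b (λ _ → 0#) ∎
                  Δ-constant : ∀ z z′ → gap f a b z ≈ 0# → gap f a b z′ ≈ 0# → dot (Δ f a b) z ≈ dot (Δ f a b) z′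
                  Δ-constant z z′ z≈0 z′≈0 =
                    trans (gap-Δ z) (trans (+-congʳ (trans z≈0 (sym z′≈0))) (sym (gap-Δ z′)))
                  gap-origin : gap f a b origin ≈ 0#
                  gap-origin = trans
                    (gap-cong f a b (λ t →
                      solve 4 (λ x δ y ε → x :+ δ :* y := x :+ δ :* (y :+ ε :* con 0ℤ)) refl (x t) δ (y t) ε))
                    (gap-b≈0 (λ _ → 0#) (sum-zero (λ t → zeroʳ (Δ f a b t))))
                  ρ≉0 : ¬ ρ ≈ 0#
                  ρ≉0 = <⇒≉ (*-pos 0<δ 0<ε)
                  dimension : HasDimension ℛ (Tie f a b) d
                  dimension = record
                    { basis       = basis origin ρ
                    ; basis∈X     = basis∈Tie
                    ; independent = basis-independent origin ρ ρ≉0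
                    ; spanning    = λ {z} (a≈b , _) → basis-spanning origin ρ ρ≉0 (Δ-constant z origin (x≈y⇒x-y≈0 a≈b) gap-origin) }

        breakpoint : HasTieOfCodimension-1 x
        breakpoint =
          let q , q-generic              = generic₂ (Δ f)
              a , a-active , a-steepest  = argmax Active (λ c → dot (slope (f c)) q) (a₀ , refl)
              p , p-generic              = generic₂ (minor q q-generic a-active a-steepest)
              b , b-rival , b-last       = argmax (Rival q q-generic a-active a-steepest)
                                             (time q q-generic a-active a-steepest p p-generic)
                                             (rival q q-generic a-active a-steepest)
              t₀ , pivot                 = nonZero-entry (proj₂ b-rival)
          in tie q q-generic a-active a-steepest p p-generic b-rival b-last pivot

  open Envelope

  -- Cells of an arrangement and the number of its regions.

  module Regions where

    ball-mono : ∀ {n} {x : Point ℛ n} {ε ε′} → ε ≤ ε′ → Ball ℛ x ε ⊆ Ball ℛ x ε′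
    ball-mono {x = x} {ε} {ε′} ε≤ε′ {y} y∈ t =
        ≤-<-trans (≤-by (≤⇒0≤- ε≤ε′) (solve 3 (λ x ε ε′ → ε′ :- ε := x :- ε :- (x :- ε′)) refl (x t) ε ε′)) (proj₁ (y∈ t))
      , <-≤-trans (proj₂ (y∈ t)) (≤-by (≤⇒0≤- ε≤ε′) (solve 3 (λ x ε ε′ → ε′ :- ε := x :+ ε′ :- (x :+ ε)) refl (x t) ε ε′))

    open⇒small : ∀ {n} {U : Pred (Point ℛ n) 0ℓ} → IsOpen ℛ U → ∀ {x} → x ∈ U → Small (λ ε → Ball ℛ x ε ⊆ U)
    open⇒small {U = U} openU {x} x∈U with openU x x∈U
    ... | ε , 0<ε , ball⊆U = ε , 0<ε , λ δ _ δ≤ε y∈ → ball⊆U (ball-mono δ≤ε y∈)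

    open-∩ : ∀ {n} {U V : Pred (Point ℛ n) 0ℓ} → IsOpen ℛ U → IsOpen ℛ V → IsOpen ℛ (U ∩ V)
    open-∩ openU openV x (x∈U , x∈V) = small-witness (small-map {Q = λ ε → Ball ℛ x ε ⊆ _}
      (λ _ _ (⊆U , ⊆V) {y} y∈ → ⊆U {y} y∈ , ⊆V {y} y∈)
      (small-× (open⇒small openU x∈U) (open⇒small openV x∈V)))

    open-∀ : ∀ {n k} {U : Fin k → Pred (Point ℛ n) 0ℓ} → (∀ c → IsOpen ℛ (U c)) → IsOpen ℛ (λ x → ∀ c → U c x)
    open-∀ openU x x∈U = small-witness (small-map {Q = λ ε → Ball ℛ x ε ⊆ _}
      (λ _ _ ⊆U {y} y∈ c → ⊆U c {y} y∈)
      (small-∀ (λ c → open⇒small (openU c) (x∈U c))))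

    convex-∩ : ∀ {n} {P Q : Pred (Point ℛ n) 0ℓ} → Convex P → Convex Q → Convex (P ∩ Q)
    convex-∩ convexP convexQ (x∈P , x∈Q) (y∈P , y∈Q) 0≤c c≤1 z≋ =
      convexP x∈P y∈P 0≤c c≤1 z≋ , convexQ x∈Q y∈Q 0≤c c≤1 z≋

    openConvex-∩ : ∀ {n} {P Q : Pred (Point ℛ n) 0ℓ} → OpenConvex P → OpenConvex Q → OpenConvex (P ∩ Q)
    openConvex-∩ (openP , convexP) (openQ , convexQ) = open-∩ openP openQ , convex-∩ convexP convexQ

    openConvex-constant : ∀ {n} (D : Set) → OpenConvex {n} (λ _ → D)
    openConvex-constant D = (λ _ d → 1# , 0<1 , λ _ → d) , λ d _ _ _ _ → d

    openConvex-∀ : ∀ {n k} {P : Fin k → Pred (Point ℛ n) 0ℓ} → (∀ c → OpenConvex (P c)) →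
                   OpenConvex (λ x → ∀ c → P c x)
    openConvex-∀ oc = open-∀ (proj₁ ∘ oc) ,
      λ x∈ y∈ 0≤c c≤1 z≋ c → proj₂ (oc c) (x∈ c) (y∈ c) 0≤c c≤1 z≋

    openConvex-→ : ∀ {n} (D : Set) {P : Pred (Point ℛ n) 0ℓ} → OpenConvex P → OpenConvex (λ x → D → P x)
    openConvex-→ D {P} (openP , convexP) = openD , λ x∈ y∈ 0≤c c≤1 z≋ d → convexP (x∈ d) (y∈ d) 0≤c c≤1 z≋
      where
      openD : IsOpen ℛ (λ x → D → P x)
      openD x x∈ with em 0ℓ {D}
      ... | no ¬d = 1# , 0<1 , λ _ d → contradiction d ¬d
      ... | yes d with openP x (x∈ d)
      ...   | ε , 0<ε , ball⊆P = ε , 0<ε , λ y∈ _ → ball⊆P y∈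

    -- `N` is the sum of the |s t|, the norm dual to the sup-norm of the balls. A lower bound
    -- suffices, because only the positivity of a gap has to survive on a ball.
    dot-lipschitz : ∀ {n} (s : Vector Carrier n) →
      ∃[ N ] (∀ {x ε y} → y ∈ Ball ℛ x ε → 0# ≤ dot s (y ⊖ x) + ε * N)
    dot-lipschitz {zero} s = 0# , λ {_} {ε} _ → ≤.reflexive (solve 1 (λ ε → con 0ℤ := con 0ℤ :+ ε :* con 0ℤ) refl ε)
    dot-lipschitz {suc n} s with dot-lipschitz (s ∘ suc) | ≤.total 0# (s zero)
    ... | N , bound | inj₁ 0≤s = s zero + N , λ {x} {ε} {y} y∈ → ≤-resp-≈ refl
            (solve 6 (λ s x y ε d N → s :* (y :- (x :- ε)) :+ (d :+ ε :* N) := s :* (y :- x) :+ d :+ ε :* (s :+ N)) refl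
              (s zero) (x zero) (y zero) ε (dot (s ∘ suc) (λ t → y (suc t) - x (suc t))) N)
            (+-nonneg (*-nonneg 0≤s (≤⇒0≤- (proj₁ (proj₁ (y∈ zero))))) (bound (y∈ ∘ suc)))
    ... | N , bound | inj₂ s≤0 = - s zero + N , λ {x} {ε} {y} y∈ → ≤-resp-≈ refl
            (solve 6 (λ s x y ε d N → :- s :* (x :+ ε :- y) :+ (d :+ ε :* N) := s :* (y :- x) :+ d :+ ε :* (:- s :+ N)) refl
              (s zero) (x zero) (y zero) ε (dot (s ∘ suc) (λ t → y (suc t) - x (suc t))) N)
            (+-nonneg (*-nonneg (neg⇒0≤- s≤0) (≤⇒0≤- (proj₁ (proj₂ (y∈ zero))))) (bound (y∈ ∘ suc)))

    module _ {n K} (f : Fin K → AffineFunction ℛ n) where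

      gap-segment : ∀ a b x y c {z} → z ≋ segment x y c → gap f a b z ≈ gap f a b x + c * dot (Δ f a b) (y ⊖ x)
      gap-segment a b x y c z≋ = trans (gap-cong f a b z≋) (gap-⊹ f a b x c (y ⊖ x))

      gap-difference : ∀ a b x y → gap f a b y ≈ gap f a b x + 1# * dot (Δ f a b) (y ⊖ x)
      gap-difference a b x y = gap-segment a b x y 1# (λ t → solve 2 (λ x y → y := x :+ con 1ℤ :* (y :- x)) refl (x t) (y t))

      Below : Fin K → Fin K → Pred (Point ℛ n) 0ℓ
      Below b a x = eval (f b) x < eval (f a) x

      Below-openConvex : ∀ a b → OpenConvex (Below b a)
      Below-openConvex a b = openB , convexB
        where
        openB : IsOpen ℛ (Below b a)
        openB x b<a with dot-lipschitz (Δ f a b)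
        ... | N , bound = small-witness (small-map
          (λ ε _ 0< {y} y∈ → 0<-⇒< (<-resp-≈ refl
            (trans (solve 4 (λ g ε N d → g :+ ε :* :- N :+ (d :+ ε :* N) := g :+ con 1ℤ :* d)
                      refl (gap f a b x) ε N (dot (Δ f a b) (y ⊖ x)))
              (sym (gap-difference a b x y)))
            (+-pos-nonneg 0< (bound y∈))))
          (small-+* (<⇒0<- b<a) (- N)))
        convexB : Convex (Below b a)
        convexB {x} {y} b<a b<a′ {c} 0≤c c≤1 {z} z≋ = go (c ≈? 0#)
          where
          gap-z : gap f a b z ≈ c * gap f a b y + (1# - c) * gap f a b x
          gap-z = begin
            gap f a b z
              ≈⟨ gap-segment a b x y c z≋ ⟩
            gap f a b x + c * dot (Δ f a b) (y ⊖ x)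
              ≈⟨ solve 3 (λ g c d → g :+ c :* d := c :* (g :+ con 1ℤ :* d) :+ (con 1ℤ :- c) :* g)
                   refl (gap f a b x) c (dot (Δ f a b) (y ⊖ x)) ⟩
            c * (gap f a b x + 1# * dot (Δ f a b) (y ⊖ x)) + (1# - c) * gap f a b x
              ≈⟨ +-congʳ (*-congˡ (gap-difference a b x y)) ⟨
            c * gap f a b y + (1# - c) * gap f a b x ∎
            where open import Relation.Binary.Reasoning.Setoid setoid
          go : Dec (c ≈ 0#) → Below b a z
          -- Strictness below comes from c times the gap at y, so c ≈ 0 is handled apart.
          go (yes c≈0) = 0<-⇒< (<-resp-≈ refl (sym (trans gap-z (trans
            (+-cong (trans (*-congʳ c≈0) (zeroˡ _)) (*-congʳ (+-congˡ (-‿cong c≈0))))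
            (solve 1 (λ g → con 0ℤ :+ (con 1ℤ :- con 0ℤ) :* g := g) refl (gap f a b x))))) (<⇒0<- b<a))
          go (no c≉0) = 0<-⇒< (<-resp-≈ refl (sym gap-z)
            (+-pos-nonneg (*-pos (0≤c , c≉0 ∘ sym) (<⇒0<- b<a′)) (*-nonneg (≤⇒0≤- c≤1) (proj₁ (<⇒0<- b<a)))))

      Same-sym : ∀ {a b} → Same f a b → Same f b a
      Same-sym a≈b x = sym (a≈b x)

      Same-trans : ∀ {a b c} → Same f a b → Same f b c → Same f a c
      Same-trans a≈b b≈c x = trans (a≈b x) (b≈c x)

      -- Pieces may coincide as functions; of coinciding pieces only the first gets a region.
      Region : Fin K → Pred (Point ℛ n) 0ℓ
      Region a x = ∀ c → (¬ Same f a c → Below c a x) × (Same f a c → a Fin.≤ c)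

      Region-openConvex : ∀ a → OpenConvex (Region a)
      Region-openConvex a = openConvex-∀ λ c →
        openConvex-∩ (openConvex-→ _ (Below-openConvex a c)) (openConvex-constant _)

      Region-unique : ∀ {x} a b → Region a x → Region b x → a ≡ b
      Region-unique a b x∈Ra x∈Rb with em 0ℓ {Same f a b}
      ... | yes a≈b = Fin.≤-antisym (proj₂ (x∈Ra b) a≈b) (proj₂ (x∈Rb a) (Same-sym a≈b))
      ... | no a≉b  = contradiction (proj₁ (x∈Rb a) (a≉b ∘ Same-sym)) (≤⇒≯ (proj₁ (proj₁ (x∈Ra b) a≉b)))

      Region-max : ∀ {a x} → Region a x → ∀ c → eval (f c) x ≤ eval (f a) x
      Region-max {a} {x} x∈R c with em 0ℓ {Same f a c}
      ... | yes a≈c = ≤.reflexive (sym (a≈c x))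
      ... | no a≉c  = proj₁ (proj₁ (x∈R c) a≉c)

      -- If a and b attain the maximum at x, they coincide with c as functions. The tie then
      -- contains the open region of c, whereas codimension 1 leaves no interior.
      Region⇒∉Tie : ∀ {x a b c} → Region c x → HasCodimension ℛ (Tie f a b) 1 → x ∉ Tie f a b
      Region⇒∉Tie {x} {a} {b} {c} x∈R codim x∈T@(a≈b , a-max) =
        codimension-1-has-no-interior codim x∈T λ d → small-map
          (λ δ _ z∈R → trans (sym (same-a _)) (same-b _) ,
                       λ e → ≤.trans (Region-max z∈R e) (≤.reflexive (same-a _)))
          (open-line (proj₁ (Region-openConvex c)) x∈R d)
        where
        same : ∀ {e} → eval (f c) x ≤ eval (f e) x → Same f c e
        same {e} c≤e = decidable-stable (em 0ℓ {Same f c e}) (λ ¬s → ≤⇒≯ c≤e (proj₁ (x∈R e) ¬s))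
        same-a : Same f c a
        same-a = same (a-max c)
        same-b : Same f c b
        same-b = same (≤.trans (a-max c) (≤.reflexive a≈b))

      least : ∀ {k} (P : Fin k → Set) → ∃ P → ∃[ a ] P a × (∀ c → P c → a Fin.≤ c)
      least {suc k} P ∃P with em 0ℓ {P zero}
      ... | yes P0 = zero , P0 , λ _ _ → ℕ.z≤n
      ... | no ¬P0 with least (P ∘ suc) (Sum.[ (λ P0 → contradiction P0 ¬P0) , id ]′ (Fin.∃-toSum ∃P))
      ...   | a , Pa , min = suc a , Pa , λ where
              zero    P0 → contradiction P0 ¬P0
              (suc c) Pc → ℕ.s≤s (min c Pc)

      unanimous⇒Region : ∀ {x a₀} → (∀ c → eval (f c) x ≤ eval (f a₀) x) →
        (∀ c → eval (f c) x ≈ eval (f a₀) x → Same f a₀ c) → ∃[ a ] Region a x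
      unanimous⇒Region {x} {a₀} max unanimous with least (Same f a₀) (a₀ , λ _ → refl)
      ... | a , a₀≈a , min = a , λ c →
            (λ a≉c → ≤.trans (max c) (≤.reflexive (a₀≈a x)) ,
                     λ c≈a → a≉c (Same-trans (Same-sym a₀≈a) (unanimous c (trans c≈a (sym (a₀≈a x))))))
          , λ a≈c → min c (Same-trans a₀≈a a≈c)

    tie-exists : ∀ {n K} (f : Fin K → AffineFunction ℛ n) {x a₀ c₀} →
      (∀ c → eval (f c) x ≤ eval (f a₀) x) → eval (f c₀) x ≈ eval (f a₀) x → ¬ Same f a₀ c₀ →
      ∃₂ λ a b → a ≢ b × HasCodimension ℛ (Tie f a b) 1 × x ∈ Tie f a b
    -- On ℝ⁰ affine functions that agree at one point are the same.
    tie-exists {zero}  f {x} {a₀} {c₀} _ c₀≈a₀ distinct = contradiction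
      (λ y → trans (eval-cong (f a₀) {y} {x} λ ()) (trans (sym c₀≈a₀) (eval-cong (f c₀) {x} {y} λ ()))) distinct
    tie-exists {suc d} f {x} max c₀≈a₀ distinct = Breakpoint.breakpoint f x max c₀≈a₀ distinct

    codimension-resp : ∀ {n j} {X Y : Pred (Point ℛ n) 0ℓ} → X ⊆ Y → Y ⊆ X →
                       HasCodimension ℛ X j → HasCodimension ℛ Y j
    codimension-resp X⊆Y Y⊆X (d , dim , eq) = d , record
      { basis = basis ; basis∈X = X⊆Y ∘ basis∈X ; independent = independent ; spanning = spanning ∘ Y⊆X } , eq
      where open HasDimension dim

    Tie-swap : ∀ {n K} (f : Fin K → AffineFunction ℛ n) {a b} → Tie f a b ⊆ Tie f b a
    Tie-swap f (a≈b , a-max) = sym a≈b , λ c → ≤.trans (a-max c) (≤.reflexive a≈b)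

    multiplicity-tabulate : ∀ {n k} (R : Fin k → Pred (Point ℛ n) 0ℓ) {x} →
      (∀ a b → R a x → R b x → a ≡ b) → multiplicity x (List.tabulate R) ≡ ⟦ ∃[ a ] R a x ⟧
    multiplicity-tabulate {k = zero}  R unique = ≡.sym (𝟙-no (em 0ℓ) λ ())
    multiplicity-tabulate {k = suc k} R {x} unique = ≡.trans
      (≡.cong (ℤ._+_ ⟦ R zero x ⟧) (multiplicity-tabulate (R ∘ suc) (λ a b p q → Fin.suc-injective (unique _ _ p q))))
      (case em 0ℓ {R zero x} of λ where
        (yes p) → ≡.trans (≡.cong₂ ℤ._+_ (𝟙-yes (em 0ℓ) p) (𝟙-no (em 0ℓ) λ (a , q) → contradiction (unique _ _ p q) λ ()))
                    (≡.sym (𝟙-yes (em 0ℓ) (zero , p)))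
        (no ¬p) → ≡.trans (≡.cong (ℤ._+ ⟦ ∃[ a ] R (suc a) x ⟧) (𝟙-no (em 0ℓ) ¬p)) (≡.trans (ℤ.+-identityˡ _)
                    (𝟙-cong (em 0ℓ) (em 0ℓ) (λ (a , q) → suc a , q)
                      (Sum.[ (λ p → contradiction p ¬p) , id ]′ ∘ Fin.∃-toSum))))

    ⟦⟧-× : ∀ P Q → ⟦ (P × Q) ⟧ ≡ ⟦ P ⟧ ℤ.* ⟦ Q ⟧
    ⟦⟧-× P Q = case em 0ℓ {P} of λ where
      (yes p) → ≡.trans (𝟙-cong (em 0ℓ) (em 0ℓ) proj₂ (p ,_))
                  (≡.sym (≡.trans (≡.cong (ℤ._* ⟦ Q ⟧) (𝟙-yes (em 0ℓ) p)) (ℤ.*-identityˡ ⟦ Q ⟧)))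
      (no ¬p) → ≡.trans (𝟙-no (em 0ℓ) (¬p ∘ proj₁))
                  (≡.sym (≡.trans (≡.cong (ℤ._* ⟦ Q ⟧) (𝟙-no (em 0ℓ) ¬p)) (ℤ.*-zeroˡ ⟦ Q ⟧)))

    ∏∈-⟦⟧ : ∀ {m} (S : Subset m) (G : Fin m → Set) → ∏∈ S (λ i → ⟦ G i ⟧) ≡ ⟦ (∀ i → i Subset.∈ S → G i) ⟧
    ∏∈-⟦⟧ []            G = ≡.sym (𝟙-yes (em 0ℓ) λ ())
    ∏∈-⟦⟧ (outside ∷ S) G = ≡.trans (∏∈-⟦⟧ S (G ∘ suc)) (𝟙-cong (em 0ℓ) (em 0ℓ)
      (λ { all (suc i) (Vec.there i∈S) → all i i∈S }) (λ all i i∈S → all (suc i) (Vec.there i∈S)))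
    ∏∈-⟦⟧ (inside ∷ S)  G = ≡.trans (≡.cong (ℤ._*_ ⟦ G zero ⟧) (∏∈-⟦⟧ S (G ∘ suc)))
      (≡.trans (≡.sym (⟦⟧-× (G zero) _)) (𝟙-cong (em 0ℓ) (em 0ℓ)
        (λ { (g , all) zero Vec.here → g ; (g , all) (suc i) (Vec.there i∈S) → all i i∈S })
        (λ all → all zero Vec.here , λ i i∈S → all (suc i) (Vec.there i∈S))))

    ∏∈-cong : ∀ {m} (S : Subset m) {g h : Fin m → ℤ} → (∀ i → g i ≡ h i) → ∏∈ S g ≡ ∏∈ S h
    ∏∈-cong []            eq = ≡.refl
    ∏∈-cong (outside ∷ S) eq = ∏∈-cong S (eq ∘ suc)
    ∏∈-cong (inside ∷ S)  eq = ≡.cong₂ ℤ._*_ (eq zero) (∏∈-cong S (eq ∘ suc))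

    module _ {n : ℕ} where

      meets : List (Pred (Point ℛ n) 0ℓ) → List (Pred (Point ℛ n) 0ℓ) → List (Pred (Point ℛ n) 0ℓ)
      meets = List.cartesianProductWith _∩_

      multiplicity-meets : ∀ x Ps Qs → multiplicity x (meets Ps Qs) ≡ multiplicity x Ps ℤ.* multiplicity x Qs
      multiplicity-meets x []       Qs = ≡.sym (ℤ.*-zeroˡ (multiplicity x Qs))
      multiplicity-meets x (P ∷ Ps) Qs = begin
        multiplicity x (List.map (P ∩_) Qs ++ meets Ps Qs)
          ≡⟨ ∑ₗ-++ (λ R → ⟦ R x ⟧) (List.map (P ∩_) Qs) (meets Ps Qs) ⟩
        multiplicity x (List.map (P ∩_) Qs) ℤ.+ multiplicity x (meets Ps Qs)
          ≡⟨ ≡.cong₂ ℤ._+_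
               (≡.trans (∑ₗ-map (P ∩_) (λ R → ⟦ R x ⟧) Qs) (≡.trans (∑ₗ-cong Qs (λ Q → ⟦⟧-× (P x) (Q x)))
                 (≡.sym (*-distribˡ-∑ₗ ⟦ P x ⟧ (λ Q → ⟦ Q x ⟧) Qs))))
               (multiplicity-meets x Ps Qs) ⟩
        ⟦ P x ⟧ ℤ.* multiplicity x Qs ℤ.+ multiplicity x Ps ℤ.* multiplicity x Qs
          ≡⟨ ℤ.*-distribʳ-+ (multiplicity x Qs) ⟦ P x ⟧ (multiplicity x Ps) ⟨
        multiplicity x (P ∷ Ps) ℤ.* multiplicity x Qs ∎
        where open ≡-Reasoning

      openConvex-meets : ∀ {Ps Qs} → All OpenConvex Ps → All OpenConvex Qs → All OpenConvex (meets Ps Qs)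
      openConvex-meets []         ocQs = []
      openConvex-meets (oc ∷ ocs) ocQs =
        All.++⁺ (All.map⁺ (All.map (openConvex-∩ oc) ocQs)) (openConvex-meets ocs ocQs)

      -- The nesting of `meets` makes multiplicities multiply in the pattern of `∏∈`. When no unit
      -- is chosen the whole space is the only cell, in accordance with r = 1.
      cells : ∀ {m} → (Fin m → List (Pred (Point ℛ n) 0ℓ)) → Subset m → List (Pred (Point ℛ n) 0ℓ)
      cells Q []            = (λ _ → Unit.⊤) ∷ []
      cells Q (outside ∷ S) = cells (Q ∘ suc) S
      cells Q (inside ∷ S)  = meets (Q zero) (cells (Q ∘ suc) S)

      multiplicity-cells : ∀ {m} (Q : Fin m → List (Pred (Point ℛ n) 0ℓ)) S x →
                           multiplicity x (cells Q S) ≡ ∏∈ S (λ i → multiplicity x (Q i))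
      multiplicity-cells Q []            x = ≡.trans (ℤ.+-identityʳ _) (𝟙-yes (em 0ℓ) Unit.tt)
      multiplicity-cells Q (outside ∷ S) x = multiplicity-cells (Q ∘ suc) S x
      multiplicity-cells Q (inside ∷ S)  x = ≡.trans (multiplicity-meets x (Q zero) (cells (Q ∘ suc) S))
        (≡.cong (ℤ._*_ (multiplicity x (Q zero))) (multiplicity-cells (Q ∘ suc) S x))

      openConvex-cells : ∀ {m} {Q : Fin m → List (Pred (Point ℛ n) 0ℓ)} → (∀ i → All OpenConvex (Q i)) →
                         ∀ S → All OpenConvex (cells Q S)
      openConvex-cells oc []            = openConvex-constant Unit.⊤ ∷ []
      openConvex-cells oc (outside ∷ S) = openConvex-cells (oc ∘ suc) S
      openConvex-cells oc (inside ∷ S)  = openConvex-meets (oc zero) (openConvex-cells (oc ∘ suc) S)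

      length-satisfiable : ∀ Ps → + List.length (satisfiable Ps) ≡ ∑ₗ Ps (λ P → ⟦ Satisfiable {A = Point ℛ n} P ⟧)
      length-satisfiable []       = ≡.refl
      length-satisfiable (P ∷ Ps) with em 0ℓ {Satisfiable P}
      ... | yes _ = ≡.cong (ℤ._+_ 1ℤ) (length-satisfiable Ps)
      ... | no _  = ≡.trans (length-satisfiable Ps) (≡.sym (ℤ.+-identityˡ _))

    -- An enumeration of B in the form of the injective family that `IsSimple` takes.
    elements : ∀ {m} (B : Subset m) → Fin ∣ B ∣ → Fin m
    elements (outside ∷ B) t       = suc (elements B t)
    elements (inside ∷ B)  zero    = zero
    elements (inside ∷ B)  (suc t) = suc (elements B t)

    elements∈ : ∀ {m} (B : Subset m) t → elements B t Subset.∈ B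
    elements∈ (outside ∷ B) t       = Vec.there (elements∈ B t)
    elements∈ (inside ∷ B)  zero    = Vec.here
    elements∈ (inside ∷ B)  (suc t) = Vec.there (elements∈ B t)

    elements-injective : ∀ {m} (B : Subset m) {s t} → elements B s ≡ elements B t → s ≡ t
    elements-injective (outside ∷ B)                   eq = elements-injective B (Fin.suc-injective eq)
    elements-injective (inside ∷ B) {zero}  {zero}  eq = ≡.refl
    elements-injective (inside ∷ B) {suc s} {suc t} eq = ≡.cong suc (elements-injective B (Fin.suc-injective eq))

    module _ {n m} (A : MaxoutUnits ℛ n m) where
      open MaxoutUnits A

      AvoidsAtoms : Fin m → Pred (Point ℛ n) 0ℓ
      AvoidsAtoms i x = (h : Atom i) → x ∉ Atom.carrier h

      module _ (2≤rank : ∀ i → 2 ℕ.≤ rank i) where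

        -- If two different functions shared the maximum at x, `tie-exists` would give a
        -- codimension-1 tie through x, which is an atom once its two indices are put in increasing
        -- order.
        avoids⇒Region : ∀ i {x} → AvoidsAtoms i x → ∃[ a ] Region (piece i) a x
        -- The bound 1 < `rank i` supplies the piece of index 1, so that a maximum exists.
        avoids⇒Region i {x} avoids with argmax (λ _ → Unit.⊤) (λ c → eval (piece i c) x) (Fin.fromℕ< (2≤rank i) , Unit.tt)
        ... | a₀ , _ , max = unanimous⇒Region (piece i) (λ c → max c Unit.tt) λ c c≈a₀ →
              decidable-stable (em 0ℓ) (no-tie ∘ tie-exists (piece i) (λ c → max c Unit.tt) c≈a₀)
          where
          no-tie : ¬ (∃₂ λ a b → a ≢ b × HasCodimension ℛ (Tie (piece i) a b) 1 × x ∈ Tie (piece i) a b)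
          no-tie (a , b , a≢b , codim , x∈T) with Fin.<-cmp a b
          ... | tri< a<b _ _ = avoids (record { a = a ; b = b ; a<b = a<b ; codim = codim }) x∈T
          ... | tri≈ _ a≡b _ = a≢b a≡b
          ... | tri> _ _ b<a = avoids (record { a = b ; b = a ; a<b = b<a
                  ; codim = codimension-resp (Tie-swap (piece i)) (Tie-swap (piece i)) codim }) (Tie-swap (piece i) x∈T)

        unitCells : Fin m → List (Pred (Point ℛ n) 0ℓ)
        unitCells i = List.tabulate (Region (piece i))

        unitCells-openConvex : ∀ i → All OpenConvex (unitCells i)
        unitCells-openConvex i = All.tabulate⁺ (Region-openConvex (piece i))

        unitCells-partition : ∀ i → Partitions (unitCells i) (AvoidsAtoms i)
        unitCells-partition i x = ≡.trans
          (multiplicity-tabulate (Region (piece i)) (Region-unique (piece i)))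
          (𝟙-cong (em 0ℓ) (em 0ℓ) (λ (_ , x∈R) h → Region⇒∉Tie (piece i) x∈R (Atom.codim h)) (avoids⇒Region i))

        multiplicity-unitCells : ∀ S x → multiplicity x (cells unitCells S) ≡ ∏∈ S (λ i → ⟦ AvoidsAtoms i x ⟧)
        multiplicity-unitCells S x = ≡.trans (multiplicity-cells unitCells S x)
          (∏∈-cong S (λ i → unitCells-partition i x))

        regions : Subset m → ℕ
        regions S = List.length (satisfiable (cells unitCells S))

        regionCount : ∀ S → RegionCount ℛ A S (regions S)
        regionCount S = components-of-partition (cells unitCells S) (openConvex-cells unitCells-openConvex S)
          (λ x → ≡.trans (multiplicity-unitCells S x) (∏∈-⟦⟧ S (λ i → AvoidsAtoms i x)))

        module _ (simple : IsSimple ℛ A) where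

          module _ (x : Point ℛ n) where

            hit : Subset m
            hit = Vec.tabulate (λ i → does (¬? (em 0ℓ {AvoidsAtoms i x})))

            hit-dichotomy : ∀ i → (i Subset.∈ hit × ⟦ AvoidsAtoms i x ⟧ ≡ 0ℤ) ⊎ (i Subset.∉ hit × ⟦ AvoidsAtoms i x ⟧ ≡ 1ℤ)
            hit-dichotomy i = go (em 0ℓ {AvoidsAtoms i x}) (Vec.lookup∘tabulate (λ i → does (¬? (em 0ℓ {AvoidsAtoms i x}))) i)
              where
              -- Abstracting the decision lets membership in `hit` and the value of the indicator
              -- reduce together.
              go : (d : Dec (AvoidsAtoms i x)) → Vec.lookup hit i ≡ does (¬? d) →
                   (i Subset.∈ hit × 𝟙 d ≡ 0ℤ) ⊎ (i Subset.∉ hit × 𝟙 d ≡ 1ℤ)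
              go (yes _) eq = inj₂ ((λ i∈ → contradiction (≡.trans (≡.sym (Vec.[]=⇒lookup i∈)) eq) λ ()) , ≡.refl)
              go (no _)  eq = inj₁ (Vec.lookup⇒[]= i hit eq , ≡.refl)

            hit⇒atom : ∀ {i} → i Subset.∈ hit → Σ[ h ∈ Atom i ] x ∈ Atom.carrier h
            hit⇒atom {i} i∈ with hit-dichotomy i
            ... | inj₂ (i∉ , _) = contradiction i∈ i∉
            ... | inj₁ (_ , ≡0) = decidable-stable (em 0ℓ) (λ ¬∃ →
                    contradiction (≡.trans (≡.sym (𝟙-yes (em 0ℓ) (λ h x∈h → ¬∃ (h , x∈h)))) ≡0) λ ())

            -- One atom through x is picked in each unit of `hit`. Their intersection contains x, so
            -- simplicity gives it codimension |hit|, which cannot exceed n.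
            ∣hit∣≤n : ∣ hit ∣ ℕ.≤ n
            ∣hit∣≤n with simple (elements hit) (elements-injective hit) (λ t → proj₁ (hit⇒atom (elements∈ hit t)))
            ... | inj₁ empty        = contradiction (λ t → proj₂ (hit⇒atom (elements∈ hit t))) (empty x)
            ... | inj₂ (d , _ , eq) = ≡.subst (∣ hit ∣ ℕ.≤_) eq (ℕ.m≤n+m ∣ hit ∣ d)

          weightedCells : Weighted (Pred (Point ℛ n) 0ℓ)
          weightedCells = List.concatMap (λ S → List.map (weight (suc n) S ,_) (cells unitCells S)) (subsets m)

          ∑ʷ-weightedCells : ∀ F → ∑ʷ weightedCells F ≡
            ∑ₗ (subsets m) (λ S → weight (suc n) S ℤ.* ∑ₗ (cells unitCells S) (λ P → ⟦ F P ⟧))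
          ∑ʷ-weightedCells F = ≡.trans
            (∑ₗ-concatMap (λ S → List.map (weight (suc n) S ,_) (cells unitCells S)) _ (subsets m))
            (∑ₗ-cong (subsets m) λ S → ≡.trans (∑ₗ-map (weight (suc n) S ,_) _ (cells unitCells S))
              (≡.sym (*-distribˡ-∑ₗ (weight (suc n) S) (λ P → ⟦ F P ⟧) (cells unitCells S))))

          -- At a point x the cells over S contribute the indicator that x avoids the atoms of S.
          -- Hence `weighted-sum-vanishes`, with `hit x` for B and n + 1 for q, is the pointwise
          -- hypothesis of `euler-relation`.
          weighted-regions-vanish : ∑ₗ (subsets m) (λ S → weight (suc n) S ℤ.* + regions S) ≡ 0ℤ
          weighted-regions-vanish = begin
            ∑ₗ (subsets m) (λ S → weight (suc n) S ℤ.* + regions S)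
              ≡⟨ ∑ₗ-cong (subsets m) (λ S → ≡.cong (weight (suc n) S ℤ.*_) (length-satisfiable (cells unitCells S))) ⟩
            ∑ₗ (subsets m) (λ S → weight (suc n) S ℤ.* ∑ₗ (cells unitCells S) (λ P → ⟦ Satisfiable P ⟧))
              ≡⟨ ∑ʷ-weightedCells Satisfiable ⟨
            ∑ʷ weightedCells Satisfiable
              ≡⟨ euler-relation weightedCells
                   (All.concat⁺ (All.map⁺ (All.universal (λ S → All.map⁺ (openConvex-cells unitCells-openConvex S)) (subsets m))))
                   (λ x → ≡.trans (∑ʷ-weightedCells (λ P → P x)) (≡.trans
                      (∑ₗ-cong (subsets m) (λ S → ≡.cong (weight (suc n) S ℤ.*_) (multiplicity-unitCells S x)))
                      (weighted-sum-vanishes (hit x) (λ i → ⟦ AvoidsAtoms i x ⟧) (hit-dichotomy x) (suc n) (ℕ.s≤s (∣hit∣≤n x))))) ⟩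
            0ℤ ∎
            where open ≡-Reasoning

  open Regions public

open import Algebra.Properties.Monoid.Sum using (sum⁺-syntax)
open import Data.Fin.Subset using (⊤)
open import Data.Integer.Base using (_*_; _^_)
open import Data.Integer.Properties using (+-0-monoid)
open import Data.List.Base using (map)
open import Data.Nat.Base using (_+_; _∸_; _≤_; _≥_)
open import Data.Nat.ListAction using (sum)

theorem6p2 : (∀ ℓ → ExcludedMiddle ℓ) → (ℛ : RealNumbers) →
    ∀ {n m : ℕ} (A : MaxoutUnits ℛ n m) →
    m ≥ n + 1 →
    (∀ i → 2 ≤ MaxoutUnits.rank A i) →
    IsSimple ℛ A →
    Σ[ r ∈ (Subset m → ℕ) ]
    (∀ S → RegionCount ℛ A S (r S)) ×
    + r ⊤ ≡ sum⁺-syntax +-0-monoid n (λ j →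
    -1ℤ ^ (n ∸ toℕ j) * + ((m ∸ 1 ∸ toℕ j) C (n ∸ toℕ j))
    * + sum (map r (subsetsOfSize m (toℕ j))))
theorem6p2 em ℛ {n} {m} A m≥n+1 2≤rank simple =
  regions A 2≤rank , regionCount A 2≤rank ,
  solve-for-⊤ (≡.subst (ℕ._≤ m) (ℕ.+-comm n 1) m≥n+1) (regions A 2≤rank)
    (weighted-regions-vanish A 2≤rank simple)
  where open Geometry em ℛ
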